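{- Let $V_n$, $n\ge0$, be the approximating graphs of the non-p.c.f. analog of the Sierpiński gasket (defined in the context). Then for all $n\ge0$, $$\tau(V_n)=2^{f_n}\cdot3^{g_n}\cdot5^{h_n},$$ where $f_n=\frac{2}{25}(11\cdot6^n-30n-11)$, $g_n=\frac15(2\cdot6^n+3)$ and $h_n=\frac1{25}(4\cdot6^n+30n-4)$.
   Context: The graphs $V_n$ are multigraphs (edges counted with multiplicity), each being a union of $6^n$ "cells", a cell being a triangle (three vertices with the three edges between them). $V_0$ is a single cell on vertices $x_1,x_2,x_3$ (the complete graph $K_3$). For $n\ge1$, $V_n$ is obtained from $V_{n-1}$ by replacing every cell with vertices $a,b,c$ by its barycentric subdivision: introduce four new vertices $u_{ab},u_{bc},u_{ca},o$ (new vertices introduced for different cells are distinct) and replace the cell by the six cells $\{a,u_{ab},o\},\{u_{ab},b,o\},\{b,u_{bc},o\},\{u_{bc},c,o\},\{c,u_{ca},o\},\{u_{ca},a,o\}$; the edge multiset of $V_n$ is the union (with multiplicity) of the edges of all its cells. $\tau(G)$ denotes the number of spanning trees of $G$. -}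

module Defs where

open import Data.Nat using (ℕ; zero; suc; _+_; _*_; _∸_; _^_; _<_; _/_)
open import Data.Bool using (Bool; true; false)
open import Data.Product using (Σ; ∃; _×_; _,_; proj₁; proj₂)
open import Data.Sum using (_⊎_)
open import Data.List using (List; []; _∷_; _++_; length; concatMap)
open import Data.Vec using (Vec; lookup; fromList; _[_]≔_)
open import Data.Fin using (Fin)
open import Data.Fin.Subset using (Subset)
open import Data.List.Relation.Unary.Unique.Propositional using (Unique)
open import Data.List.Membership.Propositional using (_∈_)
open import Function.Bundles using (_⇔_)
open import Relation.Nullary using (¬_)
open import Relation.Binary.PropositionalEquality using (_≡_)
open import Relation.Binary.Construct.Closure.ReflexiveTransitive using (Star)

-- Vertices are natural numbers 0 .. nV-1.  A cell is a triangle (a , b , c).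
Cell : Set
Cell = ℕ × ℕ × ℕ

record Complex : Set where
  constructor complex
  field
    nV    : ℕ
    cells : List Cell
open Complex public

-- Barycentric subdivision of a list of cells; k is the next fresh vertex label.
-- For cell (a,b,c): u_ab = k, u_bc = k+1, u_ca = k+2, o = k+3.
subdivideCells : ℕ → List Cell → List Cell
subdivideCells k [] = []
subdivideCells k ((a , b , c) ∷ cs) =
  let uab = k ; ubc = k + 1 ; uca = k + 2 ; o = k + 3 in
  (a , uab , o) ∷ (uab , b , o) ∷ (b , ubc , o) ∷ (ubc , c , o) ∷
  (c , uca , o) ∷ (uca , a , o) ∷ subdivideCells (k + 4) cs

V : ℕ → Complex
V zero = complex 3 ((0 , 1 , 2) ∷ [])
V (suc n) = complex (nV (V n) + 4 * length (cells (V n)))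
                    (subdivideCells (nV (V n)) (cells (V n)))

-- Edge multiset (as a list, with multiplicity) of a list of cells.
cellEdges : Cell → List (ℕ × ℕ)
cellEdges (a , b , c) = (a , b) ∷ (b , c) ∷ (c , a) ∷ []

edgeList : List Cell → List (ℕ × ℕ)
edgeList = concatMap cellEdges

record MultiGraph : Set where
  constructor mgraph
  field
    vertices : ℕ
    nE       : ℕ
    edges    : Vec (ℕ × ℕ) nE
open MultiGraph public

graphOf : Complex → MultiGraph
graphOf K = mgraph (nV K) (length (edgeList (cells K))) (fromList (edgeList (cells K)))

module _ (G : MultiGraph) where

  Adj : Subset (nE G) → ℕ → ℕ → Set
  Adj S u v = ∃ λ i → (lookup S i ≡ true) ×
                ((lookup (edges G) i ≡ (u , v)) ⊎ (lookup (edges G) i ≡ (v , u)))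

  Connected : Subset (nE G) → Set
  Connected S = ∀ u v → u < vertices G → v < vertices G → Star (Adj S) u v

  -- Acyclic: no selected edge lies on a cycle, i.e. for each selected edge,
  -- its endpoints are not joined by a path avoiding that edge.
  Acyclic : Subset (nE G) → Set
  Acyclic S = ∀ i → lookup S i ≡ true →
    ¬ Star (Adj (S [ i ]≔ false)) (proj₁ (lookup (edges G) i)) (proj₂ (lookup (edges G) i))

  IsSpanningTree : Subset (nE G) → Set
  IsSpanningTree S = Connected S × Acyclic S

  SpanningTreeCount : ℕ → Set
  SpanningTreeCount k = Σ (List (Subset (nE G))) λ L →
    Unique L × (∀ S → (S ∈ L) ⇔ IsSpanningTree S) × (length L ≡ k)

-- Exponents (the numerators are divisible by 25 resp. 5, so the division is exact).
f : ℕ → ℕ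
f n = (2 * (11 * 6 ^ n ∸ (30 * n + 11))) / 25

g : ℕ → ℕ
g n = (2 * 6 ^ n + 3) / 5

h : ℕ → ℕ
h n = (4 * 6 ^ n + 30 * n ∸ 4) / 25

{-# OPTIONS --safe #-}

-- Spanning trees are counted by deletion–contraction with a weight q for each edge taken and p for
-- each edge left out; such an edge behaves like a resistor of conductance q / p.  In a subdivided cell
-- whose edges all have weights (x , y), star–triangle moves at the three edge midpoints and then at
-- the barycentre, followed by merging parallel edges, leave the original triangle with conductance
-- 5y / 4x and the factor 9 x¹¹ y⁴.  Hence the weighted count of V (n + 1) at (x , y) is
-- (9 x¹¹ y⁴) ^ 6ⁿ times that of V n at (4x , 5y), and the closed form follows by induction for all
-- weights simultaneously.

module Submission where

open import Defs
open import Data.Nat using (ℕ; zero; suc; _+_; _*_; _∸_; _^_; _≤_; _<_; _/_; z≤n; s≤s; NonZero)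
open import Data.Nat.Properties
open import Data.Nat.DivMod using (m*n/n≡m)
open import Data.Nat.Tactic.RingSolver using (solve-∀)
open import Data.Bool using (true; false)
open import Data.Empty using (⊥-elim)
open import Data.Unit using (⊤; tt)
open import Data.Fin using (zero; suc)
open import Data.Fin.Subset using (Subset)
open import Data.Product using (_×_; _,_; proj₁; proj₂)
open import Data.Sum using (inj₁; inj₂)
open import Data.Vec using ([]; _∷_; lookup; fromList; _[_]≔_)
open import Data.Vec.Properties using (∷-injectiveʳ)
open import Data.List using (List; []; _∷_; _++_; length; map; downFrom)
open import Data.List.Properties using (length-++; length-map; ++-identityʳ)
open import Data.List.Membership.Propositional using (_∈_)
open import Data.List.Membership.Propositional.Properties using (∈-++⁺ˡ; ∈-++⁺ʳ; ∈-++⁻; ∈-map⁺; ∈-map⁻; ∈-downFrom⁺; ∈-downFrom⁻)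
open import Data.List.Relation.Unary.Any using (here; there)
open import Data.List.Relation.Unary.All using (All; []; _∷_; all?)
import Data.List.Relation.Unary.All as All
import Data.List.Relation.Unary.All.Properties as Allₚ
import Data.List.Relation.Binary.Pointwise as Pointwise
open import Data.List.Relation.Unary.AllPairs using ([]; _∷_)
open import Data.List.Relation.Unary.Unique.Propositional using (Unique)
import Data.List.Relation.Unary.Unique.Propositional.Properties as Uniqueₚ
open import Data.List.Relation.Binary.Pointwise using (Pointwise; []; _∷_)
open import Data.List.Relation.Binary.Permutation.Propositional using (_↭_; refl; prep; swap; trans; ↭-sym)
open import Data.List.Relation.Binary.Permutation.Propositional.Properties using (All-resp-↭; shift; shifts; ++-comm; ++⁺ˡ)
open import Function using (id; _∘_)
open import Function.Bundles using (_⇔_; mk⇔; Equivalence)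
open import Relation.Nullary using (¬_; Dec; yes; no)
open import Relation.Binary.PropositionalEquality as ≡ using (_≡_; _≢_; cong; cong₂; subst; module ≡-Reasoning)
open import Relation.Binary.Construct.Closure.ReflexiveTransitive using (Star; ε; _◅_; _◅◅_; reverse)

-- Weights are pairs rather than quotients so that everything stays in the natural numbers: each
-- local move equates multiples of two counts, and the surplus factors are cancelled afterwards,
-- which is where `x` must be nonzero. A move has to work inside the whole graph, so it is stated
-- with an arbitrary list `es` of remaining edges, and invariance under reordering brings the
-- relevant edges to the front. The list `W` of vertices to be connected is kept apart from the
-- edges because a star-triangle move deletes a vertex. Origin of 5/4, in units of y / x: at a
-- midpoint the two halves of the old edge have conductance 1, and the two copies of the edge to the
-- barycentre together have 2. This star of total 4 leaves 1/4 along the old edge and 1/2 from each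
-- end to the barycentre, and the latter joins an existing edge to make 3/2. Every corner gets two
-- such spokes, 3 in all; the star 3, 3, 3 of total 9 becomes a triangle of conductance 1, and 1 +
-- 1/4 = 5/4.

choose : {A B : Set} → Dec A → B → B → B
choose (yes _) x y = x
choose (no _) x y = y

choose-yes : {A B : Set} (d : Dec A) {x y : B} → A → choose d x y ≡ x
choose-yes (yes _) a = ≡.refl
choose-yes (no ¬a) a = ⊥-elim (¬a a)

choose-no : {A B : Set} (d : Dec A) {x y : B} → ¬ A → choose d x y ≡ y
choose-no (yes a) ¬a = ⊥-elim (¬a a)
choose-no (no _) ¬a = ≡.refl

choose-cong : {A A′ B : Set} (d : Dec A) (d′ : Dec A′) {x y x′ y′ : B} →
  (A → A′) → (A′ → A) → x ≡ x′ → y ≡ y′ → choose d x y ≡ choose d′ x′ y′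
choose-cong (yes a) d′ to from p q = ≡.trans p (≡.sym (choose-yes d′ (to a)))
choose-cong (no ¬a) d′ to from p q = ≡.trans q (≡.sym (choose-no d′ (¬a ∘ from)))

-- Partitions of the vertices, coarsened by gluing two classes

-- A labelling stands for its kernel: two vertices are in the same class when their labels agree.
Labelling : Set
Labelling = ℕ → ℕ

merge : Labelling → ℕ → ℕ → Labelling
merge P u v x = choose (P x ≟ P u) (P v) (P x)

infix 4 _⊑_
-- The partition of `Q` is the coarser one. Used in both directions it takes the place of equality,
-- because gluing in different orders gives the same classes but may give different labels.
_⊑_ : Labelling → Labelling → Set
P ⊑ Q = ∀ x y → P x ≡ P y → Q x ≡ Q y

⊑-trans : ∀ {P Q R} → P ⊑ Q → Q ⊑ R → P ⊑ R
⊑-trans p q x y e = q x y (p x y e)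

≗⇒⊑ : ∀ {P Q : Labelling} → (∀ x → P x ≡ Q x) → P ⊑ Q
≗⇒⊑ e x y p = ≡.trans (≡.sym (e x)) (≡.trans p (e y))

merge-yes : ∀ P u v x → P x ≡ P u → merge P u v x ≡ P v
merge-yes P u v x = choose-yes (P x ≟ P u)

merge-no : ∀ P u v x → P x ≢ P u → merge P u v x ≡ P x
merge-no P u v x = choose-no (P x ≟ P u)

merge-extends : ∀ P u v → P ⊑ merge P u v
merge-extends P u v x y e with P x ≟ P u
... | yes p = ≡.sym (merge-yes P u v y (≡.trans (≡.sym e) p))
... | no p = ≡.trans e (≡.sym (merge-no P u v y (p ∘ ≡.trans e)))

merge-glues : ∀ P u v → merge P u v u ≡ merge P u v v
merge-glues P u v with P v ≟ P u
... | yes p = merge-yes P u v u ≡.refl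
... | no p = merge-yes P u v u ≡.refl

-- `R` is an arbitrary relation and not the kernel of a labelling, so that it can later be
-- reachability along chosen edges.
merge-least : ∀ {P u v} (R : ℕ → ℕ → Set) →
  (∀ {x y} → R x y → R y x) → (∀ {x y z} → R x y → R y z → R x z) →
  (∀ x y → P x ≡ P y → R x y) → R u v →
  ∀ x y → merge P u v x ≡ merge P u v y → R x y
merge-least {P} {u} {v} R R-sym R-trans P⊆R uv x y e with P x ≟ P u | P y ≟ P u
... | yes p | yes q = P⊆R x y (≡.trans p (≡.sym q))
... | yes p | no q = R-trans (P⊆R x u p) (R-trans uv (P⊆R v y e))
... | no p | yes q = R-trans (P⊆R x v e) (R-trans (R-sym uv) (P⊆R u y (≡.sym q)))
... | no p | no q = P⊆R x y e

merge-⊑ : ∀ {P u v Q} → P ⊑ Q → Q u ≡ Q v → merge P u v ⊑ Q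
merge-⊑ {Q = Q} = merge-least (λ x y → Q x ≡ Q y) ≡.sym ≡.trans

merge-mono : ∀ {P Q} u v → P ⊑ Q → merge P u v ⊑ merge Q u v
merge-mono {P} {Q} u v P⊑Q = merge-⊑ (⊑-trans P⊑Q (merge-extends Q u v)) (merge-glues Q u v)

merge-swap : ∀ P u v → merge P u v ⊑ merge P v u
merge-swap P u v = merge-⊑ (merge-extends P v u) (≡.sym (merge-glues P v u))

merge-comm : ∀ P a b c d → merge (merge P a b) c d ⊑ merge (merge P c d) a b
merge-comm P a b c d =
  merge-⊑ (merge-mono a b (merge-extends P c d))
    (merge-extends (merge P c d) a b c d (merge-glues P c d))

-- If gluing `a` to `b` is what joins `u` to `v`, then one of `u`, `v` lies in the class of `a` and
-- the other in that of `b`, so the roles of the two pairs can be interchanged. This is the exchange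
-- property of the graphic matroid.
merge-exchange : ∀ P a b u v → P u ≢ P v →
  merge P a b u ≡ merge P a b v → merge P u v a ≡ merge P u v b
merge-exchange P a b u v u≢v e with P u ≟ P a | P v ≟ P a
... | yes p | yes q = ⊥-elim (u≢v (≡.trans p (≡.sym q)))
... | yes p | no q = ≡.trans (≡.sym (merge-extends P u v u a p))
      (≡.trans (merge-glues P u v) (≡.sym (merge-extends P u v b v e)))
... | no p | yes q = ≡.trans (≡.sym (merge-extends P u v v a q))
      (≡.trans (≡.sym (merge-glues P u v)) (merge-extends P u v u b e))
... | no p | no q = ⊥-elim (u≢v e)

-- Enumeration of the spanning trees

contract : (es : List (ℕ × ℕ)) → Subset (length es) → Labelling → Labelling
contract [] [] P = P
contract (e ∷ es) (false ∷ S) P = contract es S P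
contract ((u , v) ∷ es) (true ∷ S) P = contract es S (merge P u v)

contract-extends : ∀ es S P → P ⊑ contract es S P
contract-extends [] [] P x y e = e
contract-extends (e ∷ es) (false ∷ S) P = contract-extends es S P
contract-extends ((u , v) ∷ es) (true ∷ S) P =
  ⊑-trans (merge-extends P u v) (contract-extends es S (merge P u v))

contract-glues : ∀ es S P i → lookup S i ≡ true →
  contract es S P (proj₁ (lookup (fromList es) i)) ≡ contract es S P (proj₂ (lookup (fromList es) i))
contract-glues ((u , v) ∷ es) (true ∷ S) P zero ≡.refl =
  contract-extends es S (merge P u v) u v (merge-glues P u v)
contract-glues (e ∷ es) (false ∷ S) P (suc i) p = contract-glues es S P i p
contract-glues ((u , v) ∷ es) (true ∷ S) P (suc i) p = contract-glues es S (merge P u v) i p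

contract-least : ∀ (R : ℕ → ℕ → Set) →
  (∀ {x y} → R x y → R y x) → (∀ {x y z} → R x y → R y z → R x z) →
  ∀ es S P → (∀ x y → P x ≡ P y → R x y) →
  (∀ i → lookup S i ≡ true → R (proj₁ (lookup (fromList es) i)) (proj₂ (lookup (fromList es) i))) →
  ∀ x y → contract es S P x ≡ contract es S P y → R x y
contract-least R s t [] [] P P⊆R S⊆R = P⊆R
contract-least R s t (e ∷ es) (false ∷ S) P P⊆R S⊆R = contract-least R s t es S P P⊆R (S⊆R ∘ suc)
contract-least R s t ((u , v) ∷ es) (true ∷ S) P P⊆R S⊆R =
  contract-least R s t es S (merge P u v) (merge-least R s t P⊆R (S⊆R zero ≡.refl)) (S⊆R ∘ suc)

-- Acyclicity in incremental form: a chosen edge is tested only against the classes formed by the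
-- edges before it, as deletion-contraction does. `Acyclic` instead tests it against all the other
-- chosen edges.
Forest : (es : List (ℕ × ℕ)) → Subset (length es) → Labelling → Set
Forest [] [] P = ⊤
Forest (e ∷ es) (false ∷ S) P = Forest es S P
Forest ((u , v) ∷ es) (true ∷ S) P = P u ≢ P v × Forest es S (merge P u v)

Forest-resp : ∀ es S {P Q} → P ⊑ Q → Q ⊑ P → Forest es S P → Forest es S Q
Forest-resp [] [] le ge F = tt
Forest-resp (e ∷ es) (false ∷ S) le ge F = Forest-resp es S le ge F
Forest-resp ((u , v) ∷ es) (true ∷ S) le ge (n , F) =
  (n ∘ ge u v) , Forest-resp es S (merge-mono u v le) (merge-mono u v ge) F

-- By the exchange property, an edge that comes first is not closed up by a later one.
Forest-merge : ∀ es S P u v → P u ≢ P v → Forest es S (merge P u v) → contract es S P u ≢ contract es S P v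
Forest-merge [] [] P u v n F = n
Forest-merge (e ∷ es) (false ∷ S) P u v n F = Forest-merge es S P u v n F
Forest-merge ((a , b) ∷ es) (true ∷ S) P u v n (m , F) =
  Forest-merge es S (merge P a b) u v (m ∘ merge-exchange P a b u v n)
    (Forest-resp es S (merge-comm P u v a b) (merge-comm P a b u v) F)

NoCycle : (es : List (ℕ × ℕ)) → Subset (length es) → Labelling → Set
NoCycle es S P = ∀ i → lookup S i ≡ true →
  let e = lookup (fromList es) i ; Q = contract es (S [ i ]≔ false) P in Q (proj₁ e) ≢ Q (proj₂ e)

Forest⇒NoCycle : ∀ es S P → Forest es S P → NoCycle es S P
Forest⇒NoCycle (e ∷ es) (false ∷ S) P F (suc i) p = Forest⇒NoCycle es S P F i p
Forest⇒NoCycle ((u , v) ∷ es) (true ∷ S) P (n , F) zero p = Forest-merge es S P u v n F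
Forest⇒NoCycle ((u , v) ∷ es) (true ∷ S) P (n , F) (suc i) p =
  Forest⇒NoCycle es S (merge P u v) F i p

NoCycle⇒Forest : ∀ es S P → NoCycle es S P → Forest es S P
NoCycle⇒Forest [] [] P N = tt
NoCycle⇒Forest (e ∷ es) (false ∷ S) P N = NoCycle⇒Forest es S P (N ∘ suc)
NoCycle⇒Forest ((u , v) ∷ es) (true ∷ S) P N =
  (N zero ≡.refl ∘ contract-extends es S P u v) , NoCycle⇒Forest es S (merge P u v) (N ∘ suc)

-- Connectedness is measured against the fixed vertex 0. Hence a vertex that is to be eliminated
-- must differ from 0, and the vertex set must be nonempty for agreement with `Connected`.
Joined : List ℕ → Labelling → Set
Joined W P = All (λ w → P w ≡ P 0) W

joined? : ∀ W P → Dec (Joined W P)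
joined? W P = all? (λ w → P w ≟ P 0) W

trees : List ℕ → (es : List (ℕ × ℕ)) → Labelling → List (Subset (length es))
trees W [] P = choose (joined? W P) ([] ∷ []) []
trees W ((u , v) ∷ es) P =
  map (false ∷_) (trees W es P) ++
  choose (P u ≟ P v) [] (map (true ∷_) (trees W es (merge P u v)))

Tree : List ℕ → (es : List (ℕ × ℕ)) → Subset (length es) → Labelling → Set
Tree W es S P = Forest es S P × Joined W (contract es S P)

trees-sound : ∀ W es P {S} → S ∈ trees W es P → Tree W es S P
trees-sound W [] P S∈ with joined? W P
trees-sound W [] P (here ≡.refl) | yes j = tt , j
trees-sound W ((u , v) ∷ es) P S∈ with ∈-++⁻ (map (false ∷_) (trees W es P)) S∈
... | inj₁ q with _ , S∈′ , ≡.refl ← ∈-map⁻ (false ∷_) q = trees-sound W es P S∈′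
... | inj₂ q with P u ≟ P v
...   | no n with _ , S∈′ , ≡.refl ← ∈-map⁻ (true ∷_) q =
        let F , j = trees-sound W es (merge P u v) S∈′ in (n , F) , j

trees-complete : ∀ W es P S → Tree W es S P → S ∈ trees W es P
trees-complete W [] P [] (_ , j) = subst ([] ∈_) (≡.sym (choose-yes (joined? W P) j)) (here ≡.refl)
trees-complete W ((u , v) ∷ es) P (false ∷ S) T =
  ∈-++⁺ˡ (∈-map⁺ (false ∷_) (trees-complete W es P S T))
trees-complete W ((u , v) ∷ es) P (true ∷ S) ((n , F) , j) =
  ∈-++⁺ʳ (map (false ∷_) (trees W es P))
    (subst (_ ∈_) (≡.sym (choose-no (P u ≟ P v) n))
      (∈-map⁺ (true ∷_) (trees-complete W es (merge P u v) S (F , j))))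

trees-unique : ∀ W es P → Unique (trees W es P)
trees-unique W [] P with joined? W P
... | yes _ = [] ∷ []
... | no _ = []
trees-unique W ((u , v) ∷ es) P with P u ≟ P v
... | yes _ = Uniqueₚ.++⁺ (Uniqueₚ.map⁺ ∷-injectiveʳ (trees-unique W es P)) [] (λ ())
... | no _ = Uniqueₚ.++⁺ (Uniqueₚ.map⁺ ∷-injectiveʳ (trees-unique W es P))
    (Uniqueₚ.map⁺ ∷-injectiveʳ (trees-unique W es (merge P u v))) disjoint
  where
  disjoint : ∀ {S} → ¬ (S ∈ map (false ∷_) (trees W es P) × S ∈ map (true ∷_) (trees W es (merge P u v)))
  disjoint (p , q) with ∈-map⁻ (false ∷_) p | ∈-map⁻ (true ∷_) q
  ... | _ , _ , ≡.refl | _ , _ , ()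

-- Classes of the contraction are the connected components

module _ (N : ℕ) (es : List (ℕ × ℕ)) where

  private
    G : MultiGraph
    G = mgraph N (length es) (fromList es)

  Adj-sym : ∀ {S x y} → Adj G S x y → Adj G S y x
  Adj-sym (i , p , inj₁ q) = i , p , inj₂ q
  Adj-sym (i , p , inj₂ q) = i , p , inj₁ q

  Star⇒contract : ∀ S {x y} → Star (Adj G S) x y → contract es S id x ≡ contract es S id y
  Star⇒contract S ε = ≡.refl
  Star⇒contract S ((i , p , inj₁ q) ◅ r) =
    ≡.trans (subst (λ e → contract es S id (proj₁ e) ≡ contract es S id (proj₂ e)) q (contract-glues es S id i p))
      (Star⇒contract S r)
  Star⇒contract S ((i , p , inj₂ q) ◅ r) =
    ≡.trans (≡.sym (subst (λ e → contract es S id (proj₁ e) ≡ contract es S id (proj₂ e)) q (contract-glues es S id i p)))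
      (Star⇒contract S r)

  contract⇒Star : ∀ S x y → contract es S id x ≡ contract es S id y → Star (Adj G S) x y
  contract⇒Star S = contract-least (Star (Adj G S)) (reverse (Adj-sym {S})) _◅◅_ es S id
    (λ { x .x ≡.refl → ε }) (λ i p → (i , p , inj₁ ≡.refl) ◅ ε)

  Tree⇔IsSpanningTree : 0 < N → ∀ S → Tree (downFrom N) es S id ⇔ IsSpanningTree G S
  Tree⇔IsSpanningTree 0<N S = mk⇔ to from
    where
    to : Tree (downFrom N) es S id → IsSpanningTree G S
    to (F , j) =
      (λ x y x<N y<N → contract⇒Star S x y
        (≡.trans (All.lookup j (∈-downFrom⁺ x<N)) (≡.sym (All.lookup j (∈-downFrom⁺ y<N))))) ,
      (λ i p r → Forest⇒NoCycle es S id F i p (Star⇒contract (S [ i ]≔ false) r))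
    from : IsSpanningTree G S → Tree (downFrom N) es S id
    from (C , A) =
      NoCycle⇒Forest es S id (λ i p e → A i p (contract⇒Star (S [ i ]≔ false) _ _ e)) ,
      All.tabulate (λ w∈ → Star⇒contract S (C _ 0 (∈-downFrom⁻ w∈) 0<N))

  spanningTreeCount : 0 < N → SpanningTreeCount G (length (trees (downFrom N) es id))
  spanningTreeCount 0<N = trees (downFrom N) es id , trees-unique (downFrom N) es id ,
    (λ S → mk⇔ (Equivalence.to (Tree⇔IsSpanningTree 0<N S) ∘ trees-sound (downFrom N) es id)
               (trees-complete (downFrom N) es id S ∘ Equivalence.from (Tree⇔IsSpanningTree 0<N S))) ,
    ≡.refl

-- Weighted deletion–contraction

-- An edge with weights (p , q) contributes p when absent and q when present.
WEdge : Set
WEdge = (ℕ × ℕ) × (ℕ × ℕ)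

-- The homogenised Kirchhoff polynomial: the sum over spanning trees of the product of `q` over the
-- edges taken and `p` over the edges left out, computed by the same recursion as `trees`.
Z : List ℕ → List WEdge → Labelling → ℕ
Z W [] P = choose (joined? W P) 1 0
Z W (((u , v) , (p , q)) ∷ es) P =
  p * Z W es P + choose (P u ≟ P v) 0 (q * Z W es (merge P u v))

weigh : ℕ → ℕ → List (ℕ × ℕ) → List WEdge
weigh p q = map (_, (p , q))

length-trees : ∀ W es P → length (trees W es P) ≡ Z W (weigh 1 1 es) P
length-trees W [] P with joined? W P
... | yes _ = ≡.refl
... | no _ = ≡.refl
length-trees W ((u , v) ∷ es) P = ≡.trans (length-++ (map (false ∷_) (trees W es P)))
  (cong₂ _+_ (≡.trans (length-map _ (trees W es P)) (≡.trans (length-trees W es P) (≡.sym (*-identityˡ _)))) second)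
  where
  second : length (choose (P u ≟ P v) [] (map (true ∷_) (trees W es (merge P u v)))) ≡
           choose (P u ≟ P v) 0 (1 * Z W (weigh 1 1 es) (merge P u v))
  second with P u ≟ P v
  ... | yes _ = ≡.refl
  ... | no _ = ≡.trans (length-map _ (trees W es (merge P u v)))
                 (≡.trans (length-trees W es (merge P u v)) (≡.sym (*-identityˡ _)))

Z-yes : ∀ W u v p q es P → P u ≡ P v → Z W (((u , v) , (p , q)) ∷ es) P ≡ p * Z W es P
Z-yes W u v p q es P e =
  ≡.trans (cong (p * Z W es P +_) (choose-yes (P u ≟ P v) e)) (+-identityʳ _)

Z-no : ∀ W u v p q es P → P u ≢ P v →
  Z W (((u , v) , (p , q)) ∷ es) P ≡ p * Z W es P + q * Z W es (merge P u v)
Z-no W u v p q es P n = cong (p * Z W es P +_) (choose-no (P u ≟ P v) n)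

Z-resp : ∀ W es {P Q} → P ⊑ Q → Q ⊑ P → Z W es P ≡ Z W es Q
Z-resp W [] {P} {Q} le ge = choose-cong (joined? W P) (joined? W Q)
  (All.map (λ {x} → le x 0)) (All.map (λ {x} → ge x 0)) ≡.refl ≡.refl
Z-resp W (((u , v) , (p , q)) ∷ es) {P} {Q} le ge =
  cong₂ _+_ (cong (p *_) (Z-resp W es le ge))
    (choose-cong (P u ≟ P v) (Q u ≟ Q v) (le u v) (ge u v) ≡.refl
      (cong (q *_) (Z-resp W es (merge-mono u v le) (merge-mono u v ge))))

Z-∷-cong : ∀ W es es′ e → (∀ P → Z W es P ≡ Z W es′ P) → ∀ P → Z W (e ∷ es) P ≡ Z W (e ∷ es′) P
Z-∷-cong W es es′ ((u , v) , (p , q)) eq P =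
  cong₂ _+_ (cong (p *_) (eq P)) (cong (λ z → choose (P u ≟ P v) 0 (q * z)) (eq (merge P u v)))

-- A loop remains a loop after any gluing, so it only contributes its factor `p` or `r`. With two
-- non-loops, the sole delicate term is the one in which both edges are taken.
Z-swap : ∀ W e d es P → Z W (e ∷ d ∷ es) P ≡ Z W (d ∷ e ∷ es) P
Z-swap W e@((u , v) , (p , q)) d@((a , b) , (r , s)) es P = cases (P u ≟ P v) (P a ≟ P b)
  where
  open ≡-Reasoning
  A = Z W es P
  one-loop : ∀ e d → let ((u , v) , (p , q)) = e ; ((a , b) , (r , s)) = d in
    P u ≡ P v → P a ≢ P b → Z W (e ∷ d ∷ es) P ≡ Z W (d ∷ e ∷ es) P
  one-loop ((u , v) , (p , q)) ((a , b) , (r , s)) y n = begin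
    Z W (((u , v) , (p , q)) ∷ ((a , b) , (r , s)) ∷ es) P ≡⟨ Z-yes W u v p q (((a , b) , (r , s)) ∷ es) P y ⟩
    p * Z W (((a , b) , (r , s)) ∷ es) P ≡⟨ cong (p *_) (Z-no W a b r s es P n) ⟩
    p * (r * A + s * Z W es (merge P a b)) ≡⟨ arith p r s A (Z W es (merge P a b)) ⟩
    r * (p * A) + s * (p * Z W es (merge P a b))
      ≡⟨ cong₂ (λ z t → r * z + s * t) (Z-yes W u v p q es P y)
           (Z-yes W u v p q es (merge P a b) (merge-extends P a b u v y)) ⟨
    r * Z W (((u , v) , (p , q)) ∷ es) P + s * Z W (((u , v) , (p , q)) ∷ es) (merge P a b)
      ≡⟨ Z-no W a b r s (((u , v) , (p , q)) ∷ es) P n ⟨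
    Z W (((a , b) , (r , s)) ∷ ((u , v) , (p , q)) ∷ es) P ∎
    where
    arith : ∀ p r s A B → p * (r * A + s * B) ≡ r * (p * A) + s * (p * B)
    arith = solve-∀
  cases : Dec (P u ≡ P v) → Dec (P a ≡ P b) → Z W (e ∷ d ∷ es) P ≡ Z W (d ∷ e ∷ es) P
  cases (yes y) (yes y′) = begin
    Z W (e ∷ d ∷ es) P ≡⟨ Z-yes W u v p q (d ∷ es) P y ⟩
    p * Z W (d ∷ es) P ≡⟨ cong (p *_) (Z-yes W a b r s es P y′) ⟩
    p * (r * A) ≡⟨ arith p r A ⟩
    r * (p * A) ≡⟨ cong (r *_) (Z-yes W u v p q es P y) ⟨
    r * Z W (e ∷ es) P ≡⟨ Z-yes W a b r s (e ∷ es) P y′ ⟨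
    Z W (d ∷ e ∷ es) P ∎
    where
    arith : ∀ p r A → p * (r * A) ≡ r * (p * A)
    arith = solve-∀
  cases (yes y) (no n) = one-loop e d y n
  cases (no n) (yes y) = ≡.sym (one-loop d e y n)
  cases (no n) (no n′) = begin
    Z W (e ∷ d ∷ es) P ≡⟨ Z-no W u v p q (d ∷ es) P n ⟩
    p * Z W (d ∷ es) P + q * (r * B + X) ≡⟨ cong (λ z → p * z + q * (r * B + X)) (Z-no W a b r s es P n′) ⟩
    p * (r * A + s * C) + q * (r * B + X) ≡⟨ arith p q r s A B C X ⟩
    r * (p * A + q * B) + (s * (p * C) + q * X) ≡⟨ cong (λ z → r * (p * A + q * B) + (s * (p * C) + z)) qX≡sY ⟩
    r * (p * A + q * B) + (s * (p * C) + s * Y) ≡⟨ cong (r * (p * A + q * B) +_) (*-distribˡ-+ s (p * C) Y) ⟨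
    r * (p * A + q * B) + s * (p * C + Y) ≡⟨ cong (λ z → r * z + s * (p * C + Y)) (Z-no W u v p q es P n) ⟨
    r * Z W (e ∷ es) P + s * (p * C + Y) ≡⟨ Z-no W a b r s (e ∷ es) P n′ ⟨
    Z W (d ∷ e ∷ es) P ∎
    where
    B = Z W es (merge P u v)
    C = Z W es (merge P a b)
    D = Z W es (merge (merge P u v) a b)
    D′ = Z W es (merge (merge P a b) u v)
    X = choose (merge P u v a ≟ merge P u v b) 0 (s * D)
    Y = choose (merge P a b u ≟ merge P a b v) 0 (q * D′)
    arith : ∀ p q r s A B C X → p * (r * A + s * C) + q * (r * B + X) ≡ r * (p * A + q * B) + (s * (p * C) + q * X)
    arith = solve-∀
    mid : ∀ q s D → q * (s * D) ≡ s * (q * D)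
    mid = solve-∀
    D≡D′ : D ≡ D′
    D≡D′ = Z-resp W es (merge-comm P u v a b) (merge-comm P a b u v)
    qX≡sY : q * X ≡ s * Y
    -- Contracting one edge may turn the other into a loop; by exchange this happens in both orders
    -- or in neither.
    qX≡sY with merge P u v a ≟ merge P u v b
    ... | yes y = ≡.trans (*-zeroʳ q) (≡.trans (≡.sym (*-zeroʳ s))
          (cong (s *_) (≡.sym (choose-yes (merge P a b u ≟ merge P a b v) (merge-exchange P u v a b n′ y)))))
    ... | no z = ≡.trans (mid q s D) (≡.trans (cong (λ t → s * (q * t)) D≡D′)
          (cong (s *_) (≡.sym (choose-no (merge P a b u ≟ merge P a b v) (z ∘ merge-exchange P a b u v n)))))

Z-↭ : ∀ W {es es′} → es ↭ es′ → ∀ P → Z W es P ≡ Z W es′ P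
Z-↭ W refl P = ≡.refl
Z-↭ W (prep {es} {es′} e r) P = Z-∷-cong W es es′ e (Z-↭ W r) P
Z-↭ W (swap {es} {es′} e d r) P = ≡.trans (Z-swap W e d es P)
  (Z-∷-cong W (e ∷ es) (e ∷ es′) d (Z-∷-cong W es es′ e (Z-↭ W r)) P)
Z-↭ W (trans r s) P = ≡.trans (Z-↭ W r P) (Z-↭ W s P)

Z-vertices-↭ : ∀ {W W′} → W ↭ W′ → ∀ es P → Z W es P ≡ Z W′ es P
Z-vertices-↭ {W} {W′} r [] P = choose-cong (joined? W P) (joined? W′ P)
  (All-resp-↭ r) (All-resp-↭ (↭-sym r)) ≡.refl ≡.refl
Z-vertices-↭ r (((u , v) , (p , q)) ∷ es) P =
  cong₂ _+_ (cong (p *_) (Z-vertices-↭ r es P))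
    (cong (λ z → choose (P u ≟ P v) 0 (q * z)) (Z-vertices-↭ r es (merge P u v)))

infix 3 _≃_
data _≃_ : WEdge → WEdge → Set where
  same : ∀ {e} → e ≃ e
  flipped : ∀ {u v w} → (u , v) , w ≃ (v , u) , w
  reweighted : ∀ {u v p q p′ q′} → p ≡ p′ → q ≡ q′ → (u , v) , (p , q) ≃ (u , v) , (p′ , q′)

refl≃ : ∀ {es} → Pointwise _≃_ es es
refl≃ = Pointwise.refl same

Z-≃ : ∀ W {es es′} → Pointwise _≃_ es es′ → ∀ P → Z W es P ≡ Z W es′ P
Z-≃ W [] P = ≡.refl
Z-≃ W {_ ∷ es} {_ ∷ es′} (same {e} ∷ r) P = Z-∷-cong W es es′ e (Z-≃ W r) P
Z-≃ W {e ∷ es} {_ ∷ es′} (reweighted ≡.refl ≡.refl ∷ r) P = Z-∷-cong W es es′ e (Z-≃ W r) P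
Z-≃ W {_} {_ ∷ es′} (flipped {u} {v} {p , q} ∷ r) P =
  cong₂ _+_ (cong (p *_) (Z-≃ W r P))
    (choose-cong (P u ≟ P v) (P v ≟ P u) ≡.sym ≡.sym ≡.refl
      (cong (q *_) (≡.trans (Z-≃ W r (merge P u v))
        (Z-resp W es′ (merge-swap P u v) (merge-swap P v u)))))

-- Two parallel edges act as one; the common factor c of its two weights is taken out.
Z-parallel : ∀ W {u v p q p′ q′} c p″ q″ es P →
  p * p′ ≡ c * p″ → p * q′ + q * p′ ≡ c * q″ →
  Z W (((u , v) , (p , q)) ∷ ((u , v) , (p′ , q′)) ∷ es) P ≡ c * Z W (((u , v) , (p″ , q″)) ∷ es) P
Z-parallel W {u} {v} {p} {q} {p′} {q′} c p″ q″ es P e₁ e₂ with P u ≟ P v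
... | yes y = ≡.trans (a₁ p p′ A) (≡.trans (cong (_* A) e₁) (a₂ c p″ A))
  where
  A = Z W es P
  a₁ : ∀ p p′ A → p * (p′ * A + 0) + 0 ≡ p * p′ * A
  a₁ = solve-∀
  a₂ : ∀ c p A → c * p * A ≡ c * (p * A + 0)
  a₂ = solve-∀
... | no n = ≡.trans
    (cong (λ z → p * (p′ * A + q′ * B) + q * z)
      (Z-yes W u v p′ q′ es (merge P u v) (merge-glues P u v)))
    (≡.trans (a₁ p q p′ q′ A B) (≡.trans (cong₂ (λ z t → z * A + t * B) e₁ e₂) (a₂ c p″ q″ A B)))
  where
  A = Z W es P
  B = Z W es (merge P u v)
  a₁ : ∀ p q p′ q′ A B → p * (p′ * A + q′ * B) + q * (p′ * B) ≡ p * p′ * A + (p * q′ + q * p′) * B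
  a₁ = solve-∀
  a₂ : ∀ c p q A B → c * p * A + c * q * B ≡ c * (p * A + q * B)
  a₂ = solve-∀

-- Star–triangle transformation

Avoids : ℕ → List WEdge → Set
Avoids u = All (λ e → proj₁ (proj₁ e) ≢ u × proj₂ (proj₁ e) ≢ u)

-- No edge touches `u`, so `u` stays alone in its class through every contraction and is never
-- joined to 0.
Z-isolated : ∀ {u W} → 0 ≢ u → ∀ es P → (∀ x → x ≢ u → P x ≢ P u) → Avoids u es → Z (u ∷ W) es P ≡ 0
Z-isolated {u} {W} 0≢u [] P iso [] =
  choose-no (joined? (u ∷ W) P) (λ { (e ∷ _) → iso 0 0≢u (≡.sym e) })
Z-isolated {u} {W} 0≢u (((a , b) , (p , q)) ∷ es) P iso ((a≢u , b≢u) ∷ av) =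
  cong₂ _+_ (≡.trans (cong (p *_) (Z-isolated 0≢u es P iso av)) (*-zeroʳ p)) second
  where
  iso′ : ∀ x → x ≢ u → merge P a b x ≢ merge P a b u
  iso′ x x≢u e with P u ≟ P a
  ... | yes y = iso a a≢u (≡.sym y)
  ... | no _ with P x ≟ P a
  ...   | yes _ = iso b b≢u e
  ...   | no _ = iso x x≢u e
  second : choose (P a ≟ P b) 0 (q * Z (u ∷ W) es (merge P a b)) ≡ 0
  second with P a ≟ P b
  ... | yes _ = ≡.refl
  ... | no _ = ≡.trans (cong (q *_) (Z-isolated 0≢u es (merge P a b) iso′ av)) (*-zeroʳ q)

-- The state after `u` has been glued to `a`, kept in this form while further edges are contracted.
-- At the start, `redirect u a id` unfolds to `merge id u a`.
redirect : ℕ → ℕ → Labelling → Labelling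
redirect u a P x = choose (x ≟ u) (P a) (P x)

redirect-at : ∀ u a P → redirect u a P u ≡ P a
redirect-at u a P = choose-yes (u ≟ u) ≡.refl

redirect-off : ∀ {u x} a P → x ≢ u → redirect u a P x ≡ P x
redirect-off {u} {x} a P = choose-no (x ≟ u)

rename : ℕ → ℕ → ℕ → ℕ
rename u a x = choose (x ≟ u) a x

rename-at : ∀ u a → rename u a u ≡ a
rename-at u a = choose-yes (u ≟ u) ≡.refl

rename-off : ∀ {u x} a → x ≢ u → rename u a x ≡ x
rename-off {u} {x} a = choose-no (x ≟ u)

redirect-rename : ∀ u a P x → redirect u a P x ≡ P (rename u a x)
redirect-rename u a P x with x ≟ u
... | yes _ = ≡.refl
... | no _ = ≡.refl

redirect-merge : ∀ u a P s t x →
  merge (redirect u a P) s t x ≡ redirect u a (merge P (rename u a s) (rename u a t)) x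
redirect-merge u a P s t x
  rewrite redirect-rename u a P s | redirect-rename u a P t | redirect-rename u a P x
        | redirect-rename u a (merge P (rename u a s) (rename u a t)) x = ≡.refl

renameEdge : ℕ → ℕ → WEdge → WEdge
renameEdge u a ((s , t) , w) = (rename u a s , rename u a t) , w

rename-avoiding : ∀ {u} a es → Avoids u es → map (renameEdge u a) es ≡ es
rename-avoiding a [] [] = ≡.refl
rename-avoiding a (((s , t) , w) ∷ es) ((s≢u , t≢u) ∷ av) =
  cong₂ _∷_ (cong₂ (λ s t → (s , t) , w) (rename-off a s≢u) (rename-off a t≢u)) (rename-avoiding a es av)

-- Once glued to `a`, the vertex `u` is just a second name for it: it can be replaced by `a` in the
-- edges and dropped from the vertices to be connected, since `a` is among them.
Z-redirect : ∀ {u W a} → 0 ≢ u → All (_≢ u) W → a ∈ W → ∀ es P →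
  Z (u ∷ W) es (redirect u a P) ≡ Z W (map (renameEdge u a) es) P
Z-redirect {u} {W} {a} 0≢u W≢u a∈W [] P =
  choose-cong (joined? (u ∷ W) (redirect u a P)) (joined? W P) to from ≡.refl ≡.refl
  where
  to : Joined (u ∷ W) (redirect u a P) → Joined W P
  to (_ ∷ j) = All.zipWith (λ { (w≢u , e) →
    ≡.trans (≡.sym (redirect-off a P w≢u)) (≡.trans e (redirect-off a P 0≢u)) }) (W≢u , j)
  from : Joined W P → Joined (u ∷ W) (redirect u a P)
  from j = ≡.trans (redirect-at u a P) (≡.trans (All.lookup j a∈W) (≡.sym (redirect-off a P 0≢u))) ∷
    All.zipWith (λ { (w≢u , e) →
      ≡.trans (redirect-off a P w≢u) (≡.trans e (≡.sym (redirect-off a P 0≢u))) }) (W≢u , j)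
Z-redirect {u} {W} {a} 0≢u W≢u a∈W (((s , t) , (p , q)) ∷ es) P =
  cong₂ _+_ (cong (p *_) (Z-redirect 0≢u W≢u a∈W es P))
    (choose-cong (redirect u a P s ≟ redirect u a P t) (P (rename u a s) ≟ P (rename u a t))
      (λ e → ≡.trans (≡.sym (redirect-rename u a P s)) (≡.trans e (redirect-rename u a P t)))
      (λ e → ≡.trans (redirect-rename u a P s) (≡.trans e (≡.sym (redirect-rename u a P t))))
      ≡.refl
      (cong (q *_) (≡.trans
        (Z-resp (u ∷ W) es (≗⇒⊑ (redirect-merge u a P s t)) (≗⇒⊑ (≡.sym ∘ redirect-merge u a P s t)))
        (Z-redirect 0≢u W≢u a∈W es (merge P (rename u a s) (rename u a t))))))

Z-fork : ∀ W {a b c} p q r s es → a ≢ b → a ≢ c → b ≢ c →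
  Z W (((a , b) , (p , q)) ∷ ((a , c) , (r , s)) ∷ es) id ≡
  p * (r * Z W es id + s * Z W es (merge id a c)) +
  q * (r * Z W es (merge id a b) + s * Z W es (merge (merge id a b) a c))
Z-fork W {a} {b} {c} p q r s es a≢b a≢c b≢c =
  ≡.trans (Z-no W a b p q (((a , c) , (r , s)) ∷ es) id a≢b)
    (cong₂ (λ z t → p * z + q * t) (Z-no W a c r s es id a≢c)
      (Z-no W a c r s es (merge id a b) (λ e → b≢c
        (≡.trans (≡.sym (merge-yes id a b a ≡.refl)) (≡.trans e (merge-no id a b c (a≢c ∘ ≡.sym)))))))

-- Expansion over the subsets of the triangle: none, one, or two of its edges. Any two edges produce
-- the same contraction, and all three would close a cycle.
Z-triangle : ∀ W {a b c} p q₁ q₂ q₃ es → a ≢ b → a ≢ c → b ≢ c →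
  Z W (((a , b) , (p , q₁)) ∷ ((a , c) , (p , q₂)) ∷ ((b , c) , (p , q₃)) ∷ es) id ≡
  p * p * p * Z W es id +
  p * p * (q₁ * Z W es (merge id a b) + q₂ * Z W es (merge id a c) + q₃ * Z W es (merge id b c)) +
  p * (q₁ * q₂ + q₁ * q₃ + q₂ * q₃) * Z W es (merge (merge id a b) a c)
Z-triangle W {a} {b} {c} p q₁ q₂ q₃ es a≢b a≢c b≢c = begin
  Z W (((a , b) , (p , q₁)) ∷ ((a , c) , (p , q₂)) ∷ bc ∷ es) id
    ≡⟨ Z-fork W p q₁ p q₂ (bc ∷ es) a≢b a≢c b≢c ⟩
  p * (p * Z W (bc ∷ es) id + q₂ * Z W (bc ∷ es) (merge id a c)) +
  q₁ * (p * Z W (bc ∷ es) (merge id a b) + q₂ * Z W (bc ∷ es) T)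
    ≡⟨ cong₂ _+_
         (cong₂ (λ z t → p * (p * z + q₂ * t)) (Z-no W b c p q₃ es id b≢c)
           (≡.trans (Z-no W b c p q₃ es (merge id a c) b≢c′)
             (cong (λ z → p * Z W es (merge id a c) + q₃ * z) (Z-resp W es S₂⊑T T⊑S₂))))
         (cong₂ (λ z t → q₁ * (p * z + q₂ * t))
           (≡.trans (Z-no W b c p q₃ es (merge id a b) b≢c″)
             (cong (λ z → p * Z W es (merge id a b) + q₃ * z) (Z-resp W es S₁⊑T T⊑S₁)))
           (Z-yes W b c p q₃ es T bcT)) ⟩
  p * (p * (p * A + q₃ * D) + q₂ * (p * C + q₃ * E)) + q₁ * (p * (p * B + q₃ * E) + q₂ * (p * E))
    ≡⟨ arith p q₁ q₂ q₃ A B C D E ⟩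
  p * p * p * A + p * p * (q₁ * B + q₂ * C + q₃ * D) + p * (q₁ * q₂ + q₁ * q₃ + q₂ * q₃) * E ∎
  where
  open ≡-Reasoning
  bc = ((b , c) , (p , q₃))
  T = merge (merge id a b) a c
  S₁ = merge (merge id a b) b c
  S₂ = merge (merge id a c) b c
  A = Z W es id
  B = Z W es (merge id a b)
  C = Z W es (merge id a c)
  D = Z W es (merge id b c)
  E = Z W es T
  arith : ∀ p q₁ q₂ q₃ A B C D E →
    p * (p * (p * A + q₃ * D) + q₂ * (p * C + q₃ * E)) + q₁ * (p * (p * B + q₃ * E) + q₂ * (p * E)) ≡
    p * p * p * A + p * p * (q₁ * B + q₂ * C + q₃ * D) + p * (q₁ * q₂ + q₁ * q₃ + q₂ * q₃) * E
  arith = solve-∀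
  b≢c′ : merge id a c b ≢ merge id a c c
  b≢c′ e = b≢c (≡.trans (≡.sym (merge-no id a c b (a≢b ∘ ≡.sym))) (≡.trans e (merge-no id a c c (a≢c ∘ ≡.sym))))
  b≢c″ : merge id a b b ≢ merge id a b c
  b≢c″ e = b≢c (≡.trans (≡.sym (merge-no id a b b (a≢b ∘ ≡.sym))) (≡.trans e (merge-no id a b c (a≢c ∘ ≡.sym))))
  id⊑ : ∀ {Q} → id ⊑ Q
  id⊑ {Q} x y = cong Q
  abT : T a ≡ T b
  abT = merge-extends (merge id a b) a c a b (merge-glues id a b)
  acT : T a ≡ T c
  acT = merge-glues (merge id a b) a c
  bcT : T b ≡ T c
  bcT = ≡.trans (≡.sym abT) acT
  S₁⊑T : S₁ ⊑ T
  S₁⊑T = merge-⊑ {merge id a b} {b} {c} {T} (merge-extends (merge id a b) a c) bcT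
  T⊑S₁ : T ⊑ S₁
  T⊑S₁ = merge-⊑ {merge id a b} {a} {c} {S₁} (merge-extends (merge id a b) b c)
    (≡.trans (merge-extends (merge id a b) b c a b (merge-glues id a b)) (merge-glues (merge id a b) b c))
  S₂⊑T : S₂ ⊑ T
  S₂⊑T = merge-⊑ {merge id a c} {b} {c} {T} (merge-⊑ {id} {a} {c} {T} id⊑ acT) bcT
  acS₂ : S₂ a ≡ S₂ c
  acS₂ = merge-extends (merge id a c) b c a c (merge-glues id a c)
  T⊑S₂ : T ⊑ S₂
  T⊑S₂ = merge-⊑ {merge id a b} {a} {c} {S₂} (merge-⊑ {id} {a} {b} {S₂} id⊑ (≡.trans acS₂ (≡.sym (merge-glues (merge id a c) b c)))) acS₂

-- Both sides are expanded in the five ways `A` to `E` of partitioning the three corners, and the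
-- coefficients agree. The arms have conductances `rᵢ y / x`, so the triangle has `rᵢ rⱼ y / (ρ x)`;
-- the prefactors clear denominators.
Z-star-triangle : ∀ {u W a b c} x y r₁ r₂ r₃ es → 0 ≢ u → All (_≢ u) W →
  a ∈ W → b ∈ W → c ∈ W → a ≢ b → a ≢ c → b ≢ c → Avoids u es →
  let ρ = r₁ + r₂ + r₃ in
  ρ * ρ * x * Z (u ∷ W)
    (((u , a) , (x , r₁ * y)) ∷ ((u , b) , (x , r₂ * y)) ∷ ((u , c) , (x , r₃ * y)) ∷ es) id ≡
  y * Z W
    (((a , b) , (ρ * x , r₁ * r₂ * y)) ∷ ((a , c) , (ρ * x , r₁ * r₃ * y)) ∷
     ((b , c) , (ρ * x , r₂ * r₃ * y)) ∷ es) id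
Z-star-triangle {u} {W} {a} {b} {c} x y r₁ r₂ r₃ es 0≢u W≢u a∈W b∈W c∈W a≢b a≢c b≢c av = begin
  ρ * ρ * x * Z (u ∷ W) (ua ∷ ub ∷ uc ∷ es) id ≡⟨ cong (ρ * ρ * x *_) star ⟩
  ρ * ρ * x * (x * (x * (x * 0 + r₃ * y * A) + r₂ * y * (x * A + r₃ * y * D)) +
    r₁ * y * (x * (x * A + r₃ * y * C) + r₂ * y * (x * B + r₃ * y * E)))
    ≡⟨ arith x y r₁ r₂ r₃ A B C D E ⟩
  y * (ρ * x * (ρ * x) * (ρ * x) * A +
    ρ * x * (ρ * x) * (r₁ * r₂ * y * B + r₁ * r₃ * y * C + r₂ * r₃ * y * D) +
    ρ * x * (r₁ * r₂ * y * (r₁ * r₃ * y) + r₁ * r₂ * y * (r₂ * r₃ * y) + r₁ * r₃ * y * (r₂ * r₃ * y)) * E)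
    ≡⟨ cong (y *_) (Z-triangle W (ρ * x) (r₁ * r₂ * y) (r₁ * r₃ * y) (r₂ * r₃ * y) es a≢b a≢c b≢c) ⟨
  y * Z W (((a , b) , (ρ * x , r₁ * r₂ * y)) ∷ ((a , c) , (ρ * x , r₁ * r₃ * y)) ∷
     ((b , c) , (ρ * x , r₂ * r₃ * y)) ∷ es) id ∎
  where
  open ≡-Reasoning
  ρ = r₁ + r₂ + r₃
  ua ub uc : WEdge
  ua = ((u , a) , (x , r₁ * y))
  ub = ((u , b) , (x , r₂ * y))
  uc = ((u , c) , (x , r₃ * y))
  A = Z W es id
  B = Z W es (merge id a b)
  C = Z W es (merge id a c)
  D = Z W es (merge id b c)
  E = Z W es (merge (merge id a b) a c)
  u≢ : ∀ {w} → w ∈ W → u ≢ w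
  u≢ w∈W e = All.lookup W≢u w∈W (≡.sym e)
  renamed : ∀ w d p → d ∈ W → renameEdge u w ((u , d) , p) ≡ ((w , d) , p)
  renamed w d p d∈W = cong₂ (λ s t → (s , t) , p) (rename-at u w) (rename-off w (u≢ d∈W ∘ ≡.sym))
  attach : ∀ {w} → w ∈ W → ∀ fs fs′ → map (renameEdge u w) fs ≡ fs′ → Z (u ∷ W) fs (merge id u w) ≡ Z W fs′ id
  attach w∈W fs fs′ e = ≡.trans (Z-redirect 0≢u W≢u w∈W fs id) (cong (λ fs → Z W fs id) e)
  star : Z (u ∷ W) (ua ∷ ub ∷ uc ∷ es) id ≡
    x * (x * (x * 0 + r₃ * y * A) + r₂ * y * (x * A + r₃ * y * D)) +
    r₁ * y * (x * (x * A + r₃ * y * C) + r₂ * y * (x * B + r₃ * y * E))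
  star = ≡.trans (Z-no (u ∷ W) u a x (r₁ * y) (ub ∷ uc ∷ es) id (u≢ a∈W))
    (cong₂ (λ z t → x * z + r₁ * y * t)
      (≡.trans (Z-no (u ∷ W) u b x (r₂ * y) (uc ∷ es) id (u≢ b∈W))
        (cong₂ (λ z t → x * z + r₂ * y * t)
          (≡.trans (Z-no (u ∷ W) u c x (r₃ * y) es id (u≢ c∈W))
            (cong₂ (λ z t → x * z + r₃ * y * t)
              -- With no arm of the star taken, the centre is cut off: this is the 0 in the
              -- expansion.
              (Z-isolated 0≢u es id (λ _ → id) av)
              (attach c∈W es es (rename-avoiding c es av))))
          (≡.trans (attach b∈W (uc ∷ es) (((b , c) , (x , r₃ * y)) ∷ es) (cong₂ _∷_ (renamed b c (x , r₃ * y) c∈W) (rename-avoiding b es av)))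
            (Z-no W b c x (r₃ * y) es id b≢c))))
      (≡.trans
        (attach a∈W (ub ∷ uc ∷ es) (((a , b) , (x , r₂ * y)) ∷ ((a , c) , (x , r₃ * y)) ∷ es)
          (cong₂ _∷_ (renamed a b (x , r₂ * y) b∈W) (cong₂ _∷_ (renamed a c (x , r₃ * y) c∈W) (rename-avoiding a es av))))
        (Z-fork W x (r₂ * y) x (r₃ * y) es a≢b a≢c b≢c)))
  arith : ∀ x y r₁ r₂ r₃ A B C D E → let ρ = r₁ + r₂ + r₃ in
    ρ * ρ * x * (x * (x * (x * 0 + r₃ * y * A) + r₂ * y * (x * A + r₃ * y * D)) +
      r₁ * y * (x * (x * A + r₃ * y * C) + r₂ * y * (x * B + r₃ * y * E))) ≡
    y * (ρ * x * (ρ * x) * (ρ * x) * A +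
      ρ * x * (ρ * x) * (r₁ * r₂ * y * B + r₁ * r₃ * y * C + r₂ * r₃ * y * D) +
      ρ * x * (r₁ * r₂ * y * (r₁ * r₃ * y) + r₁ * r₂ * y * (r₂ * r₃ * y) + r₁ * r₃ * y * (r₂ * r₃ * y)) * E)
  arith = solve-∀

-- The subdivided cell

-- Opaque, so that unification compares edge lists instead of their exponentially large expansions.
opaque
  τ : List ℕ → List WEdge → ℕ
  τ W es = Z W es id

  τ-Z : ∀ W es → τ W es ≡ Z W es id
  τ-Z W es = ≡.refl

  τ-vertices-↭ : ∀ {W W′ es} → W ↭ W′ → τ W es ≡ τ W′ es
  τ-vertices-↭ {es = es} r = Z-vertices-↭ r es id

  τ-↭ : ∀ {W es es′} → es ↭ es′ → τ W es ≡ τ W es′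
  τ-↭ {W} r = Z-↭ W r id

  τ-≃ : ∀ {W es es′} → Pointwise _≃_ es es′ → τ W es ≡ τ W es′
  τ-≃ {W} r = Z-≃ W r id

  τ-parallel : ∀ {W u v p q p′ q′} c p″ q″ {es} → p * p′ ≡ c * p″ → p * q′ + q * p′ ≡ c * q″ →
    τ W (((u , v) , (p , q)) ∷ ((u , v) , (p′ , q′)) ∷ es) ≡ c * τ W (((u , v) , (p″ , q″)) ∷ es)
  τ-parallel {W} {p = p} {q} {p′} {q′} c p″ q″ {es} = Z-parallel W {p = p} {q} {p′} {q′} c p″ q″ es id

  τ-star-triangle : ∀ {u W a b c} x y r₁ r₂ r₃ {es} → 0 ≢ u → All (_≢ u) W →
    a ∈ W → b ∈ W → c ∈ W → a ≢ b → a ≢ c → b ≢ c → Avoids u es →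
    let ρ = r₁ + r₂ + r₃ in
    ρ * ρ * x * τ (u ∷ W)
      (((u , a) , (x , r₁ * y)) ∷ ((u , b) , (x , r₂ * y)) ∷ ((u , c) , (x , r₃ * y)) ∷ es) ≡
    y * τ W
      (((a , b) , (ρ * x , r₁ * r₂ * y)) ∷ ((a , c) , (ρ * x , r₁ * r₃ * y)) ∷
       ((b , c) , (ρ * x , r₂ * r₃ * y)) ∷ es)
  τ-star-triangle x y r₁ r₂ r₃ {es} = Z-star-triangle x y r₁ r₂ r₃ es

-- The two small cells along the side from `a` to `b`, in exactly the edge order of `edgeList`, so
-- that a subdivided cell is three halves by computation. The edge between `u` and `o` occurs twice.
half : ℕ → ℕ → ℕ → ℕ → List (ℕ × ℕ)
half a u b o = (a , u) ∷ (u , o) ∷ (o , a) ∷ (u , b) ∷ (b , o) ∷ (o , u) ∷ []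

-- What remains of a `half` once its midpoint is eliminated: conductances 3/2, 3/2 and 1/4 in units
-- of `y / x`.
spokes : ℕ → ℕ → ℕ → ℕ → ℕ → List WEdge
spokes x y a b o =
  ((b , o) , (2 * x , 3 * y)) ∷ ((a , o) , (2 * x , 3 * y)) ∷ ((a , b) , (4 * x , y)) ∷ []

-- The factor collects `x` from merging the doubled edge, `y / (16 x)` from the star with arms 1, 1,
-- 2, and `2 x` from each of the two mergings of edges to `o`.
τ-half : ∀ {u W a b o} x y .{{_ : NonZero x}} es → 0 ≢ u → All (_≢ u) W →
  a ∈ W → b ∈ W → o ∈ W → a ≢ b → a ≢ o → b ≢ o → Avoids u es →
  4 * τ (u ∷ W) (weigh x y (half a u b o) ++ es) ≡ x * x * y * τ W (spokes x y a b o ++ es)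
τ-half {u} {W} {a} {b} {o} x y es 0≢u W≢u a∈W b∈W o∈W a≢b a≢o b≢o av =
  -- The star-triangle move needs the factor `16 * x`, of which the statement supplies only 4.
  *-cancelˡ-≡ _ _ (4 * x) {{m*n≢0 4 x}} (begin
    4 * x * (4 * Z₀) ≡⟨ cong (λ z → 4 * x * (4 * z)) step₁ ⟩
    4 * x * (4 * (x * Z₁)) ≡⟨ arith₁ x Z₁ ⟩
    x * (16 * x * Z₁) ≡⟨ cong (x *_) step₂ ⟩
    x * (y * Z₂) ≡⟨ cong (λ z → x * (y * z)) step₃ ⟩
    x * (y * (2 * x * (2 * x * Z₃))) ≡⟨ arith₂ x y Z₃ ⟩
    4 * x * (x * x * y * Z₃) ∎)
  where
  open ≡-Reasoning
  ua ub uo ao bo uo₂ ao₄ bo₄ ab₄ ao₂ bo₂ : WEdge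
  ua = (u , a) , (x , y)
  ub = (u , b) , (x , y)
  uo = (u , o) , (x , y)
  ao = (a , o) , (x , y)
  bo = (b , o) , (x , y)
  uo₂ = (u , o) , (x , 2 * y)
  ao₄ = (a , o) , (4 * x , 2 * y)
  bo₄ = (b , o) , (4 * x , 2 * y)
  ab₄ = (a , b) , (4 * x , y)
  ao₂ = (a , o) , (2 * x , 3 * y)
  bo₂ = (b , o) , (2 * x , 3 * y)
  Z₀ = τ (u ∷ W) (weigh x y (half a u b o) ++ es)
  Z₁ = τ (u ∷ W) (ua ∷ ub ∷ uo₂ ∷ ao ∷ bo ∷ es)
  Z₂ = τ W (ab₄ ∷ ao₄ ∷ bo₄ ∷ ao ∷ bo ∷ es)
  Z₃ = τ W (bo₂ ∷ ao₂ ∷ ab₄ ∷ es)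
  arith₁ : ∀ x z → 4 * x * (4 * (x * z)) ≡ x * (16 * x * z)
  arith₁ = solve-∀
  arith₂ : ∀ x y z → x * (y * (2 * x * (2 * x * z))) ≡ 4 * x * (x * x * y * z)
  arith₂ = solve-∀
  double : ∀ x y → x * y + y * x ≡ x * (2 * y)
  double = solve-∀
  absent : ∀ x → 4 * x * x ≡ 2 * x * (2 * x)
  absent = solve-∀
  present : ∀ x y → 4 * x * y + 2 * y * x ≡ 2 * x * (3 * y)
  present = solve-∀
  step₁ : Z₀ ≡ x * Z₁
  step₁ = begin
    Z₀ ≡⟨ τ-≃ (flipped ∷ same ∷ flipped ∷ same ∷ same ∷ flipped ∷ refl≃) ⟩
    τ (u ∷ W) (ua ∷ uo ∷ ao ∷ ub ∷ bo ∷ uo ∷ es)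
      ≡⟨ τ-↭ (trans (shift uo (ua ∷ []) _) (prep uo (shift uo (ua ∷ ao ∷ ub ∷ bo ∷ []) es))) ⟩
    τ (u ∷ W) (uo ∷ uo ∷ ua ∷ ao ∷ ub ∷ bo ∷ es)
      ≡⟨ τ-parallel x x (2 * y) ≡.refl (double x y) ⟩
    x * τ (u ∷ W) (uo₂ ∷ ua ∷ ao ∷ ub ∷ bo ∷ es)
      ≡⟨ cong (x *_) (τ-↭
           (trans (shift ua (uo₂ ∷ []) _) (prep ua (shift ub (uo₂ ∷ ao ∷ []) (bo ∷ es))))) ⟩
    x * Z₁ ∎
  step₂ : 16 * x * Z₁ ≡ y * Z₂
  step₂ = begin
    16 * x * Z₁
      ≡⟨ cong (16 * x *_) (τ-≃
           (reweighted ≡.refl (≡.sym (*-identityˡ y)) ∷ reweighted ≡.refl (≡.sym (*-identityˡ y)) ∷ refl≃)) ⟩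
    16 * x * τ (u ∷ W) (((u , a) , (x , 1 * y)) ∷ ((u , b) , (x , 1 * y)) ∷ uo₂ ∷ ao ∷ bo ∷ es)
      ≡⟨ τ-star-triangle x y 1 1 2 0≢u W≢u a∈W b∈W o∈W a≢b a≢o b≢o
           ((≢u a∈W , ≢u o∈W) ∷ (≢u b∈W , ≢u o∈W) ∷ av) ⟩
    y * τ W (((a , b) , (4 * x , 1 * y)) ∷ ao₄ ∷ bo₄ ∷ ao ∷ bo ∷ es)
      ≡⟨ cong (y *_) (τ-≃ (reweighted ≡.refl (*-identityˡ y) ∷ refl≃)) ⟩
    y * Z₂ ∎
    where
    ≢u : ∀ {w} → w ∈ W → w ≢ u
    ≢u = All.lookup W≢u
  step₃ : Z₂ ≡ 2 * x * (2 * x * Z₃)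
  step₃ = begin
    Z₂ ≡⟨ τ-↭ (trans (shift ao₄ (ab₄ ∷ []) _) (prep ao₄ (shift ao (ab₄ ∷ bo₄ ∷ []) _))) ⟩
    τ W (ao₄ ∷ ao ∷ ab₄ ∷ bo₄ ∷ bo ∷ es)
      ≡⟨ τ-parallel (2 * x) (2 * x) (3 * y) (absent x) (present x y) ⟩
    2 * x * τ W (ao₂ ∷ ab₄ ∷ bo₄ ∷ bo ∷ es)
      ≡⟨ cong (2 * x *_) (τ-↭
           (trans (shift bo₄ (ao₂ ∷ ab₄ ∷ []) _) (prep bo₄ (shift bo (ao₂ ∷ ab₄ ∷ []) es)))) ⟩
    2 * x * τ W (bo₄ ∷ bo ∷ ao₂ ∷ ab₄ ∷ es)
      ≡⟨ cong (2 * x *_) (τ-parallel (2 * x) (2 * x) (3 * y) (absent x) (present x y)) ⟩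
    2 * x * (2 * x * Z₃) ∎

avoids-half : ∀ {z a v b o} x y → a ≢ z → v ≢ z → b ≢ z → o ≢ z → Avoids z (weigh x y (half a v b o))
avoids-half x y a v b o =
  (a , v) ∷ (v , o) ∷ (o , a) ∷ (v , b) ∷ (b , o) ∷ (o , v) ∷ []

avoids-spokes : ∀ {z a b o} x y → a ≢ z → b ≢ z → o ≢ z → Avoids z (spokes x y a b o)
avoids-spokes x y a b o = (b , o) ∷ (a , o) ∷ (a , b) ∷ []

Below : ℕ → List WEdge → Set
Below k = All (λ e → proj₁ (proj₁ e) < k × proj₂ (proj₁ e) < k)

Below⇒Avoids : ∀ {k z es} → k ≤ z → Below k es → Avoids z es
Below⇒Avoids k≤z = All.map (λ { (p , q) → <⇒≢ (<-≤-trans p k≤z) , <⇒≢ (<-≤-trans q k≤z) })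

-- Three mergings of spokes give `(4 x)³`, the star 3, 3, 3 gives `y / (81 x)`, and three mergings
-- along the sides give `(9 x)³`; together this is `576 x⁵ y`.
τ-hub : ∀ {o W a b c} x y .{{_ : NonZero x}} es → 0 ≢ o → All (_≢ o) W →
  a ∈ W → b ∈ W → c ∈ W → a ≢ b → a ≢ c → b ≢ c → Avoids o es →
  τ (o ∷ W) (spokes x y c a o ++ spokes x y b c o ++ spokes x y a b o ++ es) ≡
  576 * x ^ 5 * y * τ W (weigh (4 * x) (5 * y) ((a , b) ∷ (b , c) ∷ (c , a) ∷ []) ++ es)
τ-hub {o} {W} {a} {b} {c} x y es 0≢o W≢o a∈W b∈W c∈W a≢b a≢c b≢c av =
  *-cancelˡ-≡ _ _ (81 * x) {{m*n≢0 81 x}} (begin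
    81 * x * Z₀ ≡⟨ cong (81 * x *_) step₁ ⟩
    81 * x * (4 * x * (4 * x * (4 * x * Z₁))) ≡⟨ arith₁ x Z₁ ⟩
    64 * (x * x * x) * (81 * x * Z₁) ≡⟨ cong (64 * (x * x * x) *_) step₂ ⟩
    64 * (x * x * x) * (y * Z₂) ≡⟨ cong (λ z → 64 * (x * x * x) * (y * z)) step₃ ⟩
    64 * (x * x * x) * (y * (9 * x * (9 * x * (9 * x * Z₃)))) ≡⟨ arith₂ x y Z₃ ⟩
    81 * x * (576 * x ^ 5 * y * Z₃) ∎)
  where
  open ≡-Reasoning
  ao bo co ab bc ca ao₃ bo₃ co₃ ab₉ bc₉ ca₉ AB BC CA : WEdge
  ao = (a , o) , (2 * x , 3 * y)
  bo = (b , o) , (2 * x , 3 * y)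
  co = (c , o) , (2 * x , 3 * y)
  ab = (a , b) , (4 * x , y)
  bc = (b , c) , (4 * x , y)
  ca = (c , a) , (4 * x , y)
  ao₃ = (a , o) , (x , 3 * y)
  bo₃ = (b , o) , (x , 3 * y)
  co₃ = (c , o) , (x , 3 * y)
  ab₉ = (a , b) , (9 * x , 9 * y)
  bc₉ = (b , c) , (9 * x , 9 * y)
  ca₉ = (c , a) , (9 * x , 9 * y)
  AB = (a , b) , (4 * x , 5 * y)
  BC = (b , c) , (4 * x , 5 * y)
  CA = (c , a) , (4 * x , 5 * y)
  Z₀ = τ (o ∷ W) (ao ∷ co ∷ ca ∷ co ∷ bo ∷ bc ∷ bo ∷ ao ∷ ab ∷ es)
  Z₁ = τ (o ∷ W) (bo₃ ∷ co₃ ∷ ao₃ ∷ ca ∷ bc ∷ ab ∷ es)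
  Z₂ = τ W (bc₉ ∷ ab₉ ∷ ca₉ ∷ ca ∷ bc ∷ ab ∷ es)
  Z₃ = τ W (AB ∷ BC ∷ CA ∷ es)
  arith₁ : ∀ x z → 81 * x * (4 * x * (4 * x * (4 * x * z))) ≡ 64 * (x * x * x) * (81 * x * z)
  arith₁ = solve-∀
  arith₂ : ∀ x y z → 64 * (x * x * x) * (y * (9 * x * (9 * x * (9 * x * z)))) ≡
    81 * x * (576 * (x * (x * (x * (x * (x * 1))))) * y * z)
  arith₂ = solve-∀
  absent : ∀ x → 2 * x * (2 * x) ≡ 4 * x * x
  absent = solve-∀
  present : ∀ x y → 2 * x * (3 * y) + 3 * y * (2 * x) ≡ 4 * x * (3 * y)
  present = solve-∀
  present₉ : ∀ x y → 9 * x * y + 9 * y * (4 * x) ≡ 9 * x * (5 * y)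
  present₉ = solve-∀
  step₁ : Z₀ ≡ 4 * x * (4 * x * (4 * x * Z₁))
  step₁ = begin
    Z₀ ≡⟨ τ-↭ (prep ao (shift ao (co ∷ ca ∷ co ∷ bo ∷ bc ∷ bo ∷ []) _)) ⟩
    τ (o ∷ W) (ao ∷ ao ∷ co ∷ ca ∷ co ∷ bo ∷ bc ∷ bo ∷ ab ∷ es)
      ≡⟨ τ-parallel (4 * x) x (3 * y) (absent x) (present x y) ⟩
    4 * x * τ (o ∷ W) (ao₃ ∷ co ∷ ca ∷ co ∷ bo ∷ bc ∷ bo ∷ ab ∷ es)
      ≡⟨ cong (4 * x *_) (≡.trans
           (τ-↭ (trans (shift co (ao₃ ∷ []) _) (prep co (shift co (ao₃ ∷ ca ∷ []) _))))
           (τ-parallel (4 * x) x (3 * y) (absent x) (present x y))) ⟩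
    4 * x * (4 * x * τ (o ∷ W) (co₃ ∷ ao₃ ∷ ca ∷ bo ∷ bc ∷ bo ∷ ab ∷ es))
      ≡⟨ cong (λ z → 4 * x * (4 * x * z)) (≡.trans
           (τ-↭ (trans (shift bo (co₃ ∷ ao₃ ∷ ca ∷ []) _) (prep bo (shift bo (co₃ ∷ ao₃ ∷ ca ∷ bc ∷ []) _))))
           (τ-parallel (4 * x) x (3 * y) (absent x) (present x y))) ⟩
    4 * x * (4 * x * (4 * x * Z₁)) ∎
  step₂ : 81 * x * Z₁ ≡ y * Z₂
  step₂ = begin
    81 * x * Z₁ ≡⟨ cong (81 * x *_) (τ-≃ (flipped ∷ flipped ∷ flipped ∷ refl≃)) ⟩
    81 * x * τ (o ∷ W) (((o , b) , (x , 3 * y)) ∷ ((o , c) , (x , 3 * y)) ∷ ((o , a) , (x , 3 * y)) ∷ ca ∷ bc ∷ ab ∷ es)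
      ≡⟨ τ-star-triangle x y 3 3 3 0≢o W≢o b∈W c∈W a∈W b≢c (a≢b ∘ ≡.sym) (a≢c ∘ ≡.sym)
           ((≢o c∈W , ≢o a∈W) ∷ (≢o b∈W , ≢o c∈W) ∷ (≢o a∈W , ≢o b∈W) ∷ av) ⟩
    y * τ W (bc₉ ∷ ((b , a) , (9 * x , 9 * y)) ∷ ca₉ ∷ ca ∷ bc ∷ ab ∷ es)
      ≡⟨ cong (y *_) (τ-≃ (same ∷ flipped ∷ refl≃)) ⟩
    y * Z₂ ∎
    where
    ≢o : ∀ {w} → w ∈ W → w ≢ o
    ≢o = All.lookup W≢o
  step₃ : Z₂ ≡ 9 * x * (9 * x * (9 * x * Z₃))
  step₃ = begin
    Z₂ ≡⟨ τ-↭ (prep bc₉ (shift bc (ab₉ ∷ ca₉ ∷ ca ∷ []) _)) ⟩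
    τ W (bc₉ ∷ bc ∷ ab₉ ∷ ca₉ ∷ ca ∷ ab ∷ es)
      ≡⟨ τ-parallel (9 * x) (4 * x) (5 * y) ≡.refl (present₉ x y) ⟩
    9 * x * τ W (BC ∷ ab₉ ∷ ca₉ ∷ ca ∷ ab ∷ es)
      ≡⟨ cong (9 * x *_) (≡.trans
           (τ-↭ (trans (shift ab₉ (BC ∷ []) _) (prep ab₉ (shift ab (BC ∷ ca₉ ∷ ca ∷ []) es))))
           (τ-parallel (9 * x) (4 * x) (5 * y) ≡.refl (present₉ x y))) ⟩
    9 * x * (9 * x * τ W (AB ∷ BC ∷ ca₉ ∷ ca ∷ es))
      ≡⟨ cong (λ z → 9 * x * (9 * x * z)) (≡.trans
           (τ-↭ (trans (shift ca₉ (AB ∷ BC ∷ []) _) (prep ca₉ (shift ca (AB ∷ BC ∷ []) es))))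
           (≡.trans (τ-parallel (9 * x) (4 * x) (5 * y) ≡.refl (present₉ x y))
             (cong (9 * x *_) (τ-↭ (↭-sym (shift CA (AB ∷ BC ∷ []) es)))))) ⟩
    9 * x * (9 * x * (9 * x * Z₃)) ∎

-- Three midpoints contribute `x² y / 4` each and the barycentre `576 x⁵ y`, and 576 / 64 = 9. The
-- increasing labels serve to keep the new vertices distinct from each other and from everything in
-- `W` and `es`.
τ-cell : ∀ {u v w o W a b c} x y .{{_ : NonZero x}} es → 0 < u → u < v → v < w → w < o →
  All (_< u) W → a ∈ W → b ∈ W → c ∈ W → a ≢ b → a ≢ c → b ≢ c → Below u es →
  τ (u ∷ v ∷ w ∷ o ∷ W) (weigh x y (half a u b o ++ half b v c o ++ half c w a o) ++ es) ≡
  9 * x ^ 11 * y ^ 4 * τ W (weigh (4 * x) (5 * y) ((a , b) ∷ (b , c) ∷ (c , a) ∷ []) ++ es)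
τ-cell {u} {v} {w} {o} {W} {a} {b} {c} x y es 0<u u<v v<w w<o W<u a∈W b∈W c∈W a≢b a≢c b≢c es<u =
  *-cancelˡ-≡ _ _ 64 (begin
    64 * Z₀ ≡⟨ arith₁ Z₀ ⟩
    4 * (4 * (4 * Z₀)) ≡⟨ cong (λ z → 4 * (4 * z)) step₁ ⟩
    4 * (4 * (k * Z₁)) ≡⟨ arith₂ k Z₁ ⟩
    k * (4 * (4 * Z₁)) ≡⟨ cong (λ z → k * (4 * z)) step₂ ⟩
    k * (4 * (k * Z₂)) ≡⟨ arith₃ k Z₂ ⟩
    k * k * (4 * Z₂) ≡⟨ cong (k * k *_) step₃ ⟩
    k * k * (k * Z₃) ≡⟨ cong (λ z → k * k * (k * z))
      (τ-hub x y es (<⇒≢ 0<o) (W≢ u<o) a∈W b∈W c∈W a≢b a≢c b≢c (Below⇒Avoids (<⇒≤ u<o) es<u)) ⟩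
    k * k * (k * (576 * x ^ 5 * y * Z₄)) ≡⟨ arith₄ x y Z₄ ⟩
    64 * (9 * x ^ 11 * y ^ 4 * Z₄) ∎)
  where
  open ≡-Reasoning
  k = x * x * y
  s₁ = weigh x y (half a u b o)
  s₂ = weigh x y (half b v c o)
  s₃ = weigh x y (half c w a o)
  t₁ = spokes x y a b o
  t₂ = spokes x y b c o
  t₃ = spokes x y c a o
  Z₀ = τ (u ∷ v ∷ w ∷ o ∷ W) (s₁ ++ s₂ ++ s₃ ++ es)
  Z₁ = τ (v ∷ w ∷ o ∷ W) (s₂ ++ s₃ ++ es ++ t₁)
  Z₂ = τ (w ∷ o ∷ W) (s₃ ++ (es ++ t₁) ++ t₂)
  Z₃ = τ (o ∷ W) (t₃ ++ t₂ ++ t₁ ++ es)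
  Z₄ = τ W (weigh (4 * x) (5 * y) ((a , b) ∷ (b , c) ∷ (c , a) ∷ []) ++ es)
  arith₁ : ∀ z → 64 * z ≡ 4 * (4 * (4 * z))
  arith₁ = solve-∀
  arith₂ : ∀ k z → 4 * (4 * (k * z)) ≡ k * (4 * (4 * z))
  arith₂ = solve-∀
  arith₃ : ∀ k z → k * (4 * (k * z)) ≡ k * k * (4 * z)
  arith₃ = solve-∀
  arith₄ : ∀ x y z → let k = x * x * y in
    k * k * (k * (576 * (x * (x * (x * (x * (x * 1))))) * y * z)) ≡
    64 * (9 * (x * (x * (x * (x * (x * (x * (x * (x * (x * (x * (x * 1))))))))))) * (y * (y * (y * (y * 1)))) * z)
  arith₄ = solve-∀
  u<w = <-trans u<v v<w
  u<o = <-trans u<w w<o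
  v<o = <-trans v<w w<o
  0<v = <-trans 0<u u<v
  0<w = <-trans 0<u u<w
  0<o = <-trans 0<u u<o
  ≢u : ∀ {d} → d ∈ W → d ≢ u
  ≢u d∈W = <⇒≢ (All.lookup W<u d∈W)
  ≢above : ∀ {d z} → u < z → d ∈ W → d ≢ z
  ≢above u<z d∈W = <⇒≢ (<-trans (All.lookup W<u d∈W) u<z)
  W≢ : ∀ {z} → u < z → All (_≢ z) W
  W≢ u<z = All.map (λ d<u → <⇒≢ (<-trans d<u u<z)) W<u
  step₁ : 4 * Z₀ ≡ k * Z₁
  step₁ = ≡.trans
    (τ-half x y (s₂ ++ s₃ ++ es) (<⇒≢ 0<u)
      (>⇒≢ u<v ∷ >⇒≢ u<w ∷ >⇒≢ u<o ∷ All.map <⇒≢ W<u)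
      (there (there (there a∈W))) (there (there (there b∈W))) (there (there (here ≡.refl)))
      a≢b (≢above u<o a∈W) (≢above u<o b∈W)
      (Allₚ.++⁺ (avoids-half x y (≢u b∈W) (>⇒≢ u<v) (≢u c∈W) (>⇒≢ u<o))
        (Allₚ.++⁺ (avoids-half x y (≢u c∈W) (>⇒≢ u<w) (≢u a∈W) (>⇒≢ u<o))
          (Below⇒Avoids ≤-refl es<u))))
    -- The spokes obtained go to the back, leaving the next half in front.
    (cong (k *_) (τ-↭ (++-comm t₁ (s₂ ++ s₃ ++ es))))
  step₂ : 4 * Z₁ ≡ k * Z₂
  step₂ = ≡.trans
    (τ-half x y (s₃ ++ es ++ t₁) (<⇒≢ 0<v)
      (>⇒≢ v<w ∷ >⇒≢ v<o ∷ W≢ u<v)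
      (there (there b∈W)) (there (there c∈W)) (there (here ≡.refl))
      b≢c (≢above u<o b∈W) (≢above u<o c∈W)
      (Allₚ.++⁺ (avoids-half x y (≢above u<v c∈W) (>⇒≢ v<w) (≢above u<v a∈W) (>⇒≢ v<o))
        (Allₚ.++⁺ (Below⇒Avoids (<⇒≤ u<v) es<u)
          (avoids-spokes x y (≢above u<v a∈W) (≢above u<v b∈W) (>⇒≢ v<o)))))
    (cong (k *_) (τ-↭ (++-comm t₂ (s₃ ++ es ++ t₁))))
  step₃ : 4 * Z₂ ≡ k * Z₃
  step₃ = ≡.trans
    (τ-half x y ((es ++ t₁) ++ t₂) (<⇒≢ 0<w)
      (>⇒≢ w<o ∷ W≢ u<w)
      (there c∈W) (there a∈W) (here ≡.refl)
      (a≢c ∘ ≡.sym) (≢above u<o c∈W) (≢above u<o a∈W)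
      (Allₚ.++⁺ (Allₚ.++⁺ (Below⇒Avoids (<⇒≤ u<w) es<u)
          (avoids-spokes x y (≢above u<w a∈W) (≢above u<w b∈W) (>⇒≢ w<o)))
        (avoids-spokes x y (≢above u<w b∈W) (≢above u<w c∈W) (>⇒≢ w<o))))
    (cong (k *_) (τ-↭
      (++⁺ˡ t₃ (trans (++-comm (es ++ t₁) t₂) (++⁺ˡ t₂ (++-comm es t₁))))))

-- Collapsing all cells of a subdivision

CellBelow : ℕ → Cell → Set
CellBelow k (a , b , c) = a < k × b < k × c < k × a ≢ b × a ≢ c × b ≢ c

CellBelow-mono : ∀ {k m} → k ≤ m → ∀ {c} → CellBelow k c → CellBelow m c
CellBelow-mono k≤m (a , b , c , n) = <-≤-trans a k≤m , <-≤-trans b k≤m , <-≤-trans c k≤m , n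

fresh-bound : ∀ k n → k + 4 * suc n ≡ k + 4 + 4 * n
fresh-bound = solve-∀

-- The bound `m` on the old vertices is separate from the next fresh label `k`, which advances by
-- four from cell to cell while `m` stays fixed.
subdivideCells-below : ∀ {m} k cs → m ≤ k → All (CellBelow m) cs →
  All (CellBelow (k + 4 * length cs)) (subdivideCells k cs)
subdivideCells-below k [] m≤k [] = []
subdivideCells-below {m} k ((a , b , c) ∷ cs) m≤k ((a<m , b<m , c<m , a≢b , a≢c , b≢c) ∷ below) =
  subst (λ N → All (CellBelow N) (subdivideCells k ((a , b , c) ∷ cs))) (≡.sym (fresh-bound k (length cs)))
    (Allₚ.++⁺ (All.map (CellBelow-mono (m≤m+n (k + 4) (4 * length cs))) six)
      (subdivideCells-below (k + 4) cs (≤-trans m≤k (m≤m+n k 4)) below))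
  where
  old : ∀ {d} → d < m → d < k + 4
  old d<m = <-≤-trans d<m (≤-trans m≤k (m≤m+n k 4))
  new : ∀ {i} → i < 4 → k + i < k + 4
  new = +-monoʳ-< k
  k<k+4 : k < k + 4
  k<k+4 = m<m+n k (s≤s z≤n)
  old≢ : ∀ {d} i → d < m → d ≢ k + i
  old≢ i d<m = <⇒≢ (<-≤-trans d<m (≤-trans m≤k (m≤m+n k i)))
  old≢k : ∀ {d} → d < m → d ≢ k
  old≢k d<m = <⇒≢ (<-≤-trans d<m m≤k)
  k≢k+3 : k ≢ k + 3
  k≢k+3 = <⇒≢ (m<m+n k (s≤s z≤n))
  new≢ : ∀ {i} → i < 3 → k + i ≢ k + 3
  new≢ i<3 = <⇒≢ (+-monoʳ-< k i<3)
  1<3 : 1 < 3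
  1<3 = s≤s (s≤s z≤n)
  2<3 : 2 < 3
  2<3 = s≤s (s≤s (s≤s z≤n))
  3<4 : 3 < 4
  3<4 = n<1+n 3
  1<4 : 1 < 4
  1<4 = s≤s (s≤s z≤n)
  2<4 : 2 < 4
  2<4 = s≤s (s≤s (s≤s z≤n))
  six : All (CellBelow (k + 4))
    ((a , k , k + 3) ∷ (k , b , k + 3) ∷ (b , k + 1 , k + 3) ∷ (k + 1 , c , k + 3) ∷
     (c , k + 2 , k + 3) ∷ (k + 2 , a , k + 3) ∷ [])
  six =
    (old a<m , k<k+4 , new 3<4 , old≢k a<m , old≢ 3 a<m , k≢k+3) ∷
    (k<k+4 , old b<m , new 3<4 , old≢k b<m ∘ ≡.sym , k≢k+3 , old≢ 3 b<m) ∷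
    (old b<m , new 1<4 , new 3<4 , old≢ 1 b<m , old≢ 3 b<m , new≢ 1<3) ∷
    (new 1<4 , old c<m , new 3<4 , old≢ 1 c<m ∘ ≡.sym , new≢ 1<3 , old≢ 3 c<m) ∷
    (old c<m , new 2<4 , new 3<4 , old≢ 2 c<m , old≢ 3 c<m , new≢ 2<3) ∷
    (new 2<4 , old a<m , new 3<4 , old≢ 2 a<m ∘ ≡.sym , new≢ 2<3 , old≢ 3 a<m) ∷ []

edgeList-below : ∀ {k} x y cs → All (CellBelow k) cs → Below k (weigh x y (edgeList cs))
edgeList-below x y [] [] = []
edgeList-below x y ((a , b , c) ∷ cs) ((a< , b< , c< , _) ∷ below) =
  (a< , b<) ∷ (b< , c<) ∷ (c< , a<) ∷ edgeList-below x y cs below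

Below-mono : ∀ {k m es} → k ≤ m → Below k es → Below m es
Below-mono k≤m = All.map (λ { (p , q) → <-≤-trans p k≤m , <-≤-trans q k≤m })

downFrom-fresh : ∀ k → downFrom (k + 4) ↭ k ∷ k + 1 ∷ k + 2 ∷ k + 3 ∷ downFrom k
downFrom-fresh k rewrite +-comm k 1 | +-comm k 2 | +-comm k 3 | +-comm k 4 =
  trans (shift k (3 + k ∷ 2 + k ∷ 1 + k ∷ []) _)
    (prep k (trans (shift (1 + k) (3 + k ∷ 2 + k ∷ []) _) (prep (1 + k) (swap (3 + k) (2 + k) refl))))

-- The later cells, which have the larger fresh labels, are collapsed first, with the subdivided
-- head cell waiting in `es`. Then only the four newest vertices of the head lie above the remaining
-- edges, as `τ-cell` requires.
τ-subdivide : ∀ x y .{{_ : NonZero x}} k cs es → 0 < k → All (CellBelow k) cs → Below k es →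
  τ (downFrom (k + 4 * length cs)) (weigh x y (edgeList (subdivideCells k cs)) ++ es) ≡
  (9 * x ^ 11 * y ^ 4) ^ length cs * τ (downFrom k) (weigh (4 * x) (5 * y) (edgeList cs) ++ es)
τ-subdivide x y k [] es 0<k [] es<k =
  ≡.trans (cong (λ N → τ (downFrom N) es) (+-identityʳ k)) (≡.sym (*-identityˡ _))
τ-subdivide x y k ((a , b , c) ∷ cs) es 0<k (abc@(a<k , b<k , c<k , a≢b , a≢c , b≢c) ∷ below) es<k = begin
  τ (downFrom (k + 4 * suc (length cs))) (s ++ T ++ es)
    ≡⟨ cong (λ N → τ (downFrom N) (s ++ T ++ es)) (fresh-bound k (length cs)) ⟩
  τ (downFrom (k + 4 + 4 * length cs)) (s ++ T ++ es) ≡⟨ τ-↭ (shifts s T) ⟩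
  τ (downFrom (k + 4 + 4 * length cs)) (T ++ s ++ es)
    ≡⟨ τ-subdivide x y (k + 4) cs (s ++ es) (<-≤-trans 0<k (m≤m+n k 4))
         (All.map (CellBelow-mono (m≤m+n k 4)) below) (Allₚ.++⁺ s-below (Below-mono (m≤m+n k 4) es<k)) ⟩
  F ^ length cs * τ (downFrom (k + 4)) (T′ ++ s ++ es)
    ≡⟨ cong (F ^ length cs *_) (≡.trans (τ-vertices-↭ (downFrom-fresh k)) (τ-↭ (shifts T′ s))) ⟩
  F ^ length cs * τ (k ∷ k + 1 ∷ k + 2 ∷ k + 3 ∷ downFrom k) (s ++ T′ ++ es)
    ≡⟨ cong (F ^ length cs *_)
         (τ-cell x y (T′ ++ es) 0<k (m<m+n k (s≤s z≤n)) (+-monoʳ-< k (n<1+n 1)) (+-monoʳ-< k (n<1+n 2))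
           (All.tabulate ∈-downFrom⁻) (∈-downFrom⁺ a<k) (∈-downFrom⁺ b<k) (∈-downFrom⁺ c<k) a≢b a≢c b≢c
           (Allₚ.++⁺ (edgeList-below (4 * x) (5 * y) cs below) es<k)) ⟩
  F ^ length cs * (F * τ (downFrom k) (weigh (4 * x) (5 * y) (edgeList ((a , b , c) ∷ cs)) ++ es))
    ≡⟨ arith F (F ^ length cs) _ ⟩
  F ^ suc (length cs) * τ (downFrom k) (weigh (4 * x) (5 * y) (edgeList ((a , b , c) ∷ cs)) ++ es) ∎
  where
  open ≡-Reasoning
  F = 9 * x ^ 11 * y ^ 4
  s = weigh x y (half a k b (k + 3) ++ half b (k + 1) c (k + 3) ++ half c (k + 2) a (k + 3))
  T = weigh x y (edgeList (subdivideCells (k + 4) cs))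
  T′ = weigh (4 * x) (5 * y) (edgeList cs)
  s-below : Below (k + 4) s
  -- The edges of the head are bounded by treating it as a subdivision of a single cell.
  s-below = subst (λ N → Below N s) (≡.trans (fresh-bound k 0) (+-identityʳ (k + 4)))
    (edgeList-below x y _ (subdivideCells-below k ((a , b , c) ∷ []) ≤-refl (abc ∷ [])))
  arith : ∀ F G t → G * (F * t) ≡ F * G * t
  arith = solve-∀

length-subdivideCells : ∀ k cs → length (subdivideCells k cs) ≡ 6 * length cs
length-subdivideCells k [] = ≡.refl
length-subdivideCells k (_ ∷ cs) =
  ≡.trans (cong (6 +_) (length-subdivideCells (k + 4) cs)) (≡.sym (*-suc 6 (length cs)))

length-cells : ∀ n → length (cells (V n)) ≡ 6 ^ n
length-cells zero = ≡.refl
length-cells (suc n) =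
  ≡.trans (length-subdivideCells (nV (V n)) (cells (V n))) (cong (6 *_) (length-cells n))

V-nonempty : ∀ n → 0 < nV (V n)
V-nonempty zero = s≤s z≤n
V-nonempty (suc n) = <-≤-trans (V-nonempty n) (m≤m+n _ _)

V-below : ∀ n → All (CellBelow (nV (V n))) (cells (V n))
V-below zero = (s≤s z≤n , s≤s (s≤s z≤n) , n<1+n 2 , (λ ()) , (λ ()) , (λ ())) ∷ []
V-below (suc n) = subdivideCells-below (nV (V n)) (cells (V n)) ≤-refl (V-below n)

-- Exponents

-- α n and β n are the numbers of edges of V n outside, respectively inside, a spanning tree.
α β e₂ e₃ e₅ : ℕ → ℕ
α zero = 1
α (suc n) = 11 * 6 ^ n + α n
β zero = 2
β (suc n) = 4 * 6 ^ n + β n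
e₂ zero = 0
e₂ (suc n) = 2 * α n + e₂ n
e₃ zero = 1
e₃ (suc n) = 2 * 6 ^ n + e₃ n
e₅ zero = 0
e₅ (suc n) = β n + e₅ n

^-distribʳ-* : ∀ k m n → (m * n) ^ k ≡ m ^ k * n ^ k
^-distribʳ-* zero m n = ≡.refl
^-distribʳ-* (suc k) m n =
  ≡.trans (cong (m * n *_) (^-distribʳ-* k m n)) ([m*n]*[o*p]≡[m*o]*[n*p] m n (m ^ k) (n ^ k))

-- Replacing `(x , y)` by `(4 * x , 5 * y)` in the formula for `n` releases `4 ^ α n` and `5 ^ β n`,
-- which feed `e₂` and `e₅`; the 9 per cell feeds `e₃`.
τ-V : ∀ n x y .{{_ : NonZero x}} →
  τ (downFrom (nV (V n))) (weigh x y (edgeList (cells (V n)))) ≡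
  x ^ α n * y ^ β n * (2 ^ e₂ n * 3 ^ e₃ n * 5 ^ e₅ n)
τ-V zero x y = ≡.trans (τ-Z _ _) (base x y)
  where
  -- The left side is the recursion evaluated on the concrete triangle: three trees, each taking two
  -- edges and leaving one out.
  base : ∀ x y → x * (x * (x * 0 + y * 0) + y * (x * 0 + y * 1)) + y * (x * (x * 0 + y * 1) + y * (x * 1 + 0)) ≡ x * 1 * (y * (y * 1)) * 3
  base = solve-∀
τ-V (suc n) x y = begin
  τ (downFrom (nV (V (suc n)))) (weigh x y (edgeList (cells (V (suc n)))))
    ≡⟨ cong (τ _) (++-identityʳ _) ⟨
  τ (downFrom (nV (V (suc n)))) (weigh x y (edgeList (cells (V (suc n)))) ++ [])
    ≡⟨ τ-subdivide x y (nV (V n)) (cells (V n)) [] (V-nonempty n) (V-below n) [] ⟩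
  (9 * x ^ 11 * y ^ 4) ^ length (cells (V n)) *
    τ (downFrom (nV (V n))) (weigh (4 * x) (5 * y) (edgeList (cells (V n))) ++ [])
    ≡⟨ cong₂ (λ m es → (9 * x ^ 11 * y ^ 4) ^ m * τ (downFrom (nV (V n))) es) (length-cells n) (++-identityʳ _) ⟩
  (9 * x ^ 11 * y ^ 4) ^ m * τ (downFrom (nV (V n))) (weigh (4 * x) (5 * y) (edgeList (cells (V n))))
    ≡⟨ cong ((9 * x ^ 11 * y ^ 4) ^ m *_) (τ-V n (4 * x) (5 * y) {{m*n≢0 4 x}}) ⟩
  (9 * x ^ 11 * y ^ 4) ^ m * ((4 * x) ^ α n * (5 * y) ^ β n * (2 ^ e₂ n * 3 ^ e₃ n * 5 ^ e₅ n))
    ≡⟨ cong₂ (λ z t → z * (t * (2 ^ e₂ n * 3 ^ e₃ n * 5 ^ e₅ n))) powers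
         (cong₂ _*_ (≡.trans (^-distribʳ-* (α n) 4 x) (cong (_* x ^ α n) (^-*-assoc 2 2 (α n)))) (^-distribʳ-* (β n) 5 y)) ⟩
  3 ^ (2 * m) * x ^ (11 * m) * y ^ (4 * m) *
    (2 ^ (2 * α n) * x ^ α n * (5 ^ β n * y ^ β n) * (2 ^ e₂ n * 3 ^ e₃ n * 5 ^ e₅ n))
    ≡⟨ arith (3 ^ (2 * m)) (x ^ (11 * m)) (y ^ (4 * m)) (2 ^ (2 * α n)) (x ^ α n) (5 ^ β n) (y ^ β n)
         (2 ^ e₂ n) (3 ^ e₃ n) (5 ^ e₅ n) ⟩
  x ^ (11 * m) * x ^ α n * (y ^ (4 * m) * y ^ β n) *
    (2 ^ (2 * α n) * 2 ^ e₂ n * (3 ^ (2 * m) * 3 ^ e₃ n) * (5 ^ β n * 5 ^ e₅ n))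
    ≡⟨ cong₂ _*_ (cong₂ _*_ (^-distribˡ-+-* x (11 * m) (α n)) (^-distribˡ-+-* y (4 * m) (β n)))
         (cong₂ _*_ (cong₂ _*_ (^-distribˡ-+-* 2 (2 * α n) (e₂ n)) (^-distribˡ-+-* 3 (2 * m) (e₃ n)))
           (^-distribˡ-+-* 5 (β n) (e₅ n))) ⟨
  x ^ α (suc n) * y ^ β (suc n) * (2 ^ e₂ (suc n) * 3 ^ e₃ (suc n) * 5 ^ e₅ (suc n)) ∎
  where
  open ≡-Reasoning
  m = 6 ^ n
  powers : (9 * x ^ 11 * y ^ 4) ^ m ≡ 3 ^ (2 * m) * x ^ (11 * m) * y ^ (4 * m)
  powers = ≡.trans (^-distribʳ-* m (9 * x ^ 11) (y ^ 4))
    (cong₂ _*_ (≡.trans (^-distribʳ-* m 9 (x ^ 11)) (cong₂ _*_ (^-*-assoc 3 2 m) (^-*-assoc x 11 m)))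
      (^-*-assoc y 4 m))
  arith : ∀ A B C D E F G H I J →
    A * B * C * (D * E * (F * G) * (H * I * J)) ≡ B * E * (C * G) * (D * H * (A * I) * (F * J))
  arith = solve-∀

α-closed : ∀ n → 5 * α n + 6 ≡ 11 * 6 ^ n
α-closed zero = ≡.refl
α-closed (suc n) = ≡.trans (a₁ (6 ^ n) (α n)) (≡.trans (cong (55 * 6 ^ n +_) (α-closed n)) (a₂ (6 ^ n)))
  where
  a₁ : ∀ m a → 5 * (11 * m + a) + 6 ≡ 55 * m + (5 * a + 6)
  a₁ = solve-∀
  a₂ : ∀ m → 55 * m + 11 * m ≡ 11 * (6 * m)
  a₂ = solve-∀

β-closed : ∀ n → 5 * β n ≡ 4 * 6 ^ n + 6
β-closed zero = ≡.refl
β-closed (suc n) = ≡.trans (a₁ (6 ^ n) (β n)) (≡.trans (cong (20 * 6 ^ n +_) (β-closed n)) (a₂ (6 ^ n)))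
  where
  a₁ : ∀ m b → 5 * (4 * m + b) ≡ 20 * m + 5 * b
  a₁ = solve-∀
  a₂ : ∀ m → 20 * m + (4 * m + 6) ≡ 4 * (6 * m) + 6
  a₂ = solve-∀

-- Written as a sum, this also shows that the truncated subtraction in `f` never cuts anything off
-- and that the division is exact.
e₂-closed : ∀ n → e₂ n * 25 + 2 * (30 * n + 11) ≡ 2 * (11 * 6 ^ n)
e₂-closed zero = ≡.refl
e₂-closed (suc n) = begin
  (2 * α n + e₂ n) * 25 + 2 * (30 * suc n + 11) ≡⟨ a₁ (α n) (e₂ n) n ⟩
  10 * (5 * α n + 6) + (e₂ n * 25 + 2 * (30 * n + 11)) ≡⟨ cong₂ (λ z t → 10 * z + t) (α-closed n) (e₂-closed n) ⟩
  10 * (11 * 6 ^ n) + 2 * (11 * 6 ^ n) ≡⟨ a₂ (6 ^ n) ⟩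
  2 * (11 * 6 ^ suc n) ∎
  where
  open ≡-Reasoning
  a₁ : ∀ a e n → (2 * a + e) * 25 + 2 * (30 * (1 + n) + 11) ≡ 10 * (5 * a + 6) + (e * 25 + 2 * (30 * n + 11))
  a₁ = solve-∀
  a₂ : ∀ m → 10 * (11 * m) + 2 * (11 * m) ≡ 2 * (11 * (6 * m))
  a₂ = solve-∀

e₃-closed : ∀ n → e₃ n * 5 ≡ 2 * 6 ^ n + 3
e₃-closed zero = ≡.refl
e₃-closed (suc n) = ≡.trans (a₁ (6 ^ n) (e₃ n)) (≡.trans (cong (10 * 6 ^ n +_) (e₃-closed n)) (a₂ (6 ^ n)))
  where
  a₁ : ∀ m e → (2 * m + e) * 5 ≡ 10 * m + e * 5
  a₁ = solve-∀
  a₂ : ∀ m → 10 * m + (2 * m + 3) ≡ 2 * (6 * m) + 3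
  a₂ = solve-∀

e₅-closed : ∀ n → e₅ n * 25 + 4 ≡ 4 * 6 ^ n + 30 * n
e₅-closed zero = ≡.refl
e₅-closed (suc n) = begin
  (β n + e₅ n) * 25 + 4 ≡⟨ a₁ (β n) (e₅ n) ⟩
  5 * (5 * β n) + (e₅ n * 25 + 4) ≡⟨ cong₂ (λ z t → 5 * z + t) (β-closed n) (e₅-closed n) ⟩
  5 * (4 * 6 ^ n + 6) + (4 * 6 ^ n + 30 * n) ≡⟨ a₂ (6 ^ n) n ⟩
  4 * 6 ^ suc n + 30 * suc n ∎
  where
  open ≡-Reasoning
  a₁ : ∀ b e → (b + e) * 25 + 4 ≡ 5 * (5 * b) + (e * 25 + 4)
  a₁ = solve-∀
  a₂ : ∀ m n → 5 * (4 * m + 6) + (4 * m + 30 * n) ≡ 4 * (6 * m) + 30 * (1 + n)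
  a₂ = solve-∀

e₂≡f : ∀ n → e₂ n ≡ f n
e₂≡f n = ≡.sym (≡.trans (cong (_/ 25) numerator) (m*n/n≡m (e₂ n) 25))
  where
  numerator : 2 * (11 * 6 ^ n ∸ (30 * n + 11)) ≡ e₂ n * 25
  numerator = ≡.trans (*-distribˡ-∸ 2 (11 * 6 ^ n) (30 * n + 11))
    (≡.trans (cong (_∸ 2 * (30 * n + 11)) (≡.sym (e₂-closed n))) (m+n∸n≡m (e₂ n * 25) (2 * (30 * n + 11))))

e₃≡g : ∀ n → e₃ n ≡ g n
e₃≡g n = ≡.sym (≡.trans (cong (_/ 5) (≡.sym (e₃-closed n))) (m*n/n≡m (e₃ n) 5))

e₅≡h : ∀ n → e₅ n ≡ h n
e₅≡h n = ≡.sym (≡.trans (cong (λ z → (z ∸ 4) / 25) (≡.sym (e₅-closed n)))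
  (≡.trans (cong (_/ 25) (m+n∸n≡m (e₅ n * 25) 4)) (m*n/n≡m (e₅ n) 25)))

-- Specialisation to unit weights

length-trees-V : ∀ n →
  length (trees (downFrom (nV (V n))) (edgeList (cells (V n))) id) ≡ 2 ^ f n * 3 ^ g n * 5 ^ h n
length-trees-V n = begin
  length (trees (downFrom (nV (V n))) (edgeList (cells (V n))) id)
    ≡⟨ length-trees (downFrom (nV (V n))) (edgeList (cells (V n))) id ⟩
  Z (downFrom (nV (V n))) (weigh 1 1 (edgeList (cells (V n)))) id ≡⟨ τ-Z _ _ ⟨
  τ (downFrom (nV (V n))) (weigh 1 1 (edgeList (cells (V n)))) ≡⟨ τ-V n 1 1 ⟩
  1 ^ α n * 1 ^ β n * (2 ^ e₂ n * 3 ^ e₃ n * 5 ^ e₅ n)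
    ≡⟨ cong₂ (λ z t → z * t * (2 ^ e₂ n * 3 ^ e₃ n * 5 ^ e₅ n)) (^-zeroˡ (α n)) (^-zeroˡ (β n)) ⟩
  1 * (2 ^ e₂ n * 3 ^ e₃ n * 5 ^ e₅ n) ≡⟨ *-identityˡ _ ⟩
  2 ^ e₂ n * 3 ^ e₃ n * 5 ^ e₅ n
    ≡⟨ cong₂ _*_ (cong₂ (λ z t → 2 ^ z * 3 ^ t) (e₂≡f n) (e₃≡g n)) (cong (5 ^_) (e₅≡h n)) ⟩
  2 ^ f n * 3 ^ g n * 5 ^ h n ∎
  where
  open ≡-Reasoning

theorem5p3 : ∀ (n : ℕ) → SpanningTreeCount (graphOf (V n)) (2 ^ f n * 3 ^ g n * 5 ^ h n)
theorem5p3 n = subst (SpanningTreeCount (graphOf (V n))) (length-trees-V n)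
  (spanningTreeCount (nV (V n)) (edgeList (cells (V n))) (V-nonempty n))
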